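{- Let $U$ be a model of $\mathrm{ZFU}_{\mathrm R}$ + DC-scheme, equipped with its definable classes. The following are equivalent. (1) $U \models$ "$\mathscr{A}$ is a set". (2) $U$ has a definable map (from classes to objects) that fulfills Basic Law V. (3) $U$ has a parametrically definable map (from classes to objects) that fulfills Basic Law V.
   Context: The language of urelement set theory has $\in$ and a unary predicate $\mathscr{A}$ for urelements; $\mathscr{A}$ also denotes the class of all urelements, and a set is an object that is not a urelement. $\mathrm{ZFU}_{\mathrm R}$ has the axioms: urelements have no members; Extensionality for sets (sets with the same members are equal); Foundation; Pairing; Union; Powerset; Infinity; the Separation schema; the Replacement schema. The urelements may form a proper class; "$\mathscr{A}$ is a set" means that some set has exactly the urelements as its members. The DC-scheme is the schema: for every formula $\varphi$ and parameter $u$, if for every $x$ there is some $y$ with $\varphi(x,y,u)$, then for every $p$ there is an infinite sequence $s$ (a function with domain $\omega$) such that $s(0)=p$ and $\varphi(s(n),s(n+1),u)$ for every $n<\omega$. Given a model $U$, its definable classes are the collections $\{x\in U: U\models\psi(x,z)\}$ with $\psi$ a first-order formula and $z\in U$ a parameter. "Equipped with definable classes" means that we consider the two-sorted structure whose objects are the elements of $U$ and whose classes are the definable classes. A map $X\mapsto\epsilon X$ from classes to objects is definable if its graph is defined over this structure by a second-order formula $\varphi(X,y)$ (quantifiers over objects and over definable classes allowed, no parameters), and parametrically definable if it is defined by a second-order formula $\varphi(X,y,P)$ with a definable class $P$ of $U$ as parameter. It fulfills Basic Law V if for all classes $X,Y$: $\epsilon X=\epsilon Y\leftrightarrow\forall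 x\,(x\in X\leftrightarrow x\in Y)$. -}

module Defs where

open import Data.Fin using (Fin)
open import Data.Nat using (ℕ; suc)
open import Data.Product using (Σ; ∃-syntax; ∃!; _×_)
open import Data.Sum using (_⊎_)
open import Data.Vec using (Vec; []; _∷_; lookup)
open import Function.Bundles using (_⇔_)
open import Level using (Level) renaming (suc to lsuc)
open import Relation.Binary.PropositionalEquality using (_≡_)
open import Relation.Nullary using (¬_)

infix  8 _≐_ _∈̇_ _∈̂_
infix  7 ¬̇_
infixr 6 _∧̇_
infixr 5 ∃̇_ ∃̂_

-- First-order formulas with free variables in Fin n. Variables are de Bruijn
-- indices: ∃̇ binds index 0. The remaining connectives are the usual classical
-- abbreviations in terms of ¬, ∧, ∃.
data Formula (n : ℕ) : Set where
  _≐_ _∈̇_ : Fin n → Fin n → Formula n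
  𝒜̇       : Fin n → Formula n
  ¬̇_      : Formula n → Formula n
  _∧̇_     : Formula n → Formula n → Formula n
  ∃̇_      : Formula (suc n) → Formula n

-- Second-order formulas with k free class variables and n free object
-- variables: x ∈̂ X is membership in a class, ∃̂ binds class index 0. Class
-- equality is not primitive; it abbreviates coextensiveness.
data Formula₂ (k n : ℕ) : Set where
  _≐_ _∈̇_ : Fin n → Fin n → Formula₂ k n
  𝒜̇       : Fin n → Formula₂ k n
  _∈̂_     : Fin n → Fin k → Formula₂ k n
  ¬̇_      : Formula₂ k n → Formula₂ k n
  _∧̇_     : Formula₂ k n → Formula₂ k n → Formula₂ k n
  ∃̇_      : Formula₂ k (suc n) → Formula₂ k n
  ∃̂_      : Formula₂ (suc k) n → Formula₂ k n

record Structure (ℓ : Level) : Set (lsuc ℓ) where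
  infix 4 _∈_
  field
    Carrier : Set ℓ
    _∈_     : Carrier → Carrier → Set ℓ
    𝒜       : Carrier → Set ℓ

module _ {ℓ : Level} (U : Structure ℓ) where
  open Structure U

  Sat : ∀ {n} → Formula n → Vec Carrier n → Set ℓ
  Sat (i ≐ j) ρ = lookup ρ i ≡ lookup ρ j
  Sat (i ∈̇ j) ρ = lookup ρ i ∈ lookup ρ j
  Sat (𝒜̇ i)   ρ = 𝒜 (lookup ρ i)
  Sat (¬̇ φ)   ρ = ¬ Sat φ ρ
  Sat (φ ∧̇ ψ) ρ = Sat φ ρ × Sat ψ ρ
  Sat (∃̇ φ)   ρ = ∃[ x ] Sat φ (x ∷ ρ)

  -- A presentation of the definable class { x | U ⊨ ψ(x , z) }. Different
  -- presentations may give the same class: sameness of classes is _≈ᶜ_.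
  record Class : Set ℓ where
    constructor ⟪_,_⟫
    field
      ψ : Formula 2
      z : Carrier

  infix 4 _∈ᶜ_ _≈ᶜ_

  _∈ᶜ_ : Carrier → Class → Set ℓ
  x ∈ᶜ ⟪ ψ , z ⟫ = Sat ψ (x ∷ z ∷ [])

  _≈ᶜ_ : Class → Class → Set ℓ
  X ≈ᶜ Y = ∀ x → x ∈ᶜ X ⇔ x ∈ᶜ Y

  Sat₂ : ∀ {k n} → Formula₂ k n → Vec Class k → Vec Carrier n → Set ℓ
  Sat₂ (i ≐ j) Γ ρ = lookup ρ i ≡ lookup ρ j
  Sat₂ (i ∈̇ j) Γ ρ = lookup ρ i ∈ lookup ρ j
  Sat₂ (𝒜̇ i)   Γ ρ = 𝒜 (lookup ρ i)
  Sat₂ (i ∈̂ j) Γ ρ = lookup ρ i ∈ᶜ lookup Γ j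
  Sat₂ (¬̇ φ)   Γ ρ = ¬ Sat₂ φ Γ ρ
  Sat₂ (φ ∧̇ ψ) Γ ρ = Sat₂ φ Γ ρ × Sat₂ ψ Γ ρ
  Sat₂ (∃̇ φ)   Γ ρ = ∃[ x ] Sat₂ φ Γ (x ∷ ρ)
  Sat₂ (∃̂ φ)   Γ ρ = ∃[ X ] Sat₂ φ (X ∷ Γ) ρ

  IsSet : Carrier → Set ℓ
  IsSet x = ¬ 𝒜 x

  IsEmpty : Carrier → Set ℓ
  IsEmpty e = IsSet e × (∀ x → ¬ x ∈ e)

  -- p = {x , y}
  IsPair : Carrier → Carrier → Carrier → Set ℓ
  IsPair p x y = IsSet p × (∀ w → w ∈ p ⇔ (w ≡ x ⊎ w ≡ y))

  -- y = x ∪ {x}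
  IsSuc : Carrier → Carrier → Set ℓ
  IsSuc y x = IsSet y × (∀ w → w ∈ y ⇔ (w ∈ x ⊎ w ≡ x))

  IsInductive : Carrier → Set ℓ
  IsInductive s = (∃[ e ] IsEmpty e × e ∈ s)
                × (∀ x → x ∈ s → ∃[ y ] IsSuc y x × y ∈ s)

  record ZFUR : Set ℓ where
    field
      urelements     : ∀ a → 𝒜 a → ∀ x → ¬ x ∈ a
      extensionality : ∀ x y → IsSet x → IsSet y → (∀ w → w ∈ x ⇔ w ∈ y) → x ≡ y
      foundation     : ∀ x → (∃[ y ] y ∈ x) → ∃[ y ] y ∈ x × (∀ w → w ∈ x → ¬ w ∈ y)
      pairing        : ∀ x y → ∃[ p ] IsPair p x y
      union          : ∀ x → ∃[ u ] IsSet u × (∀ w → w ∈ u ⇔ (∃[ y ] y ∈ x × w ∈ y))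
      powerset       : ∀ x → ∃[ p ] IsSet p ×
                         (∀ w → w ∈ p ⇔ (IsSet w × (∀ v → v ∈ w → v ∈ x)))
      infinity       : ∃[ s ] IsSet s × IsInductive s
      separation     : ∀ {n} (φ : Formula (suc n)) (u : Vec Carrier n) (x : Carrier) →
                       ∃[ y ] IsSet y × (∀ w → w ∈ y ⇔ (w ∈ x × Sat φ (w ∷ u)))
      replacement    : ∀ {n} (φ : Formula (suc (suc n))) (u : Vec Carrier n) (d : Carrier) →
                       (∀ x → x ∈ d → ∃! _≡_ (λ y → Sat φ (x ∷ y ∷ u))) →
                       ∃[ r ] IsSet r ×
                         (∀ y → y ∈ r ⇔ (∃[ x ] x ∈ d × Sat φ (x ∷ y ∷ u)))

  -- The least inductive set.
  IsOmega : Carrier → Set ℓ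
  IsOmega o = IsSet o × (∀ n → n ∈ o ⇔ (∀ s → IsInductive s → n ∈ s))

  -- Kuratowski: p = {{x} , {x , y}}
  IsOrderedPair : Carrier → Carrier → Carrier → Set ℓ
  IsOrderedPair p x y = ∃[ a ] ∃[ b ] IsPair a x x × IsPair b x y × IsPair p a b

  -- ⟨x , y⟩ ∈ f; for a function f this says f(x) = y.
  Maps : Carrier → Carrier → Carrier → Set ℓ
  Maps f x y = ∃[ p ] IsOrderedPair p x y × p ∈ f

  IsFunctionOn : Carrier → Carrier → Set ℓ
  IsFunctionOn f d = IsSet f
                   × (∀ p → p ∈ f → ∃[ x ] ∃[ y ] x ∈ d × IsOrderedPair p x y)
                   × (∀ x → x ∈ d → ∃! _≡_ (Maps f x))

  -- The sequence s, its domain and its indices are all internal to U, whose ω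
  -- may be nonstandard.
  DCScheme : Set ℓ
  DCScheme = (φ : Formula 3) (u : Carrier) →
    (∀ x → ∃[ y ] Sat φ (x ∷ y ∷ u ∷ [])) →
    ∀ p → ∃[ s ] ∃[ o ] IsOmega o × IsFunctionOn s o
      × (∃[ e ] IsEmpty e × Maps s e p)
      × (∀ n → n ∈ o → ∃[ m ] ∃[ x ] ∃[ y ]
           IsSuc m n × Maps s n x × Maps s m y × Sat φ (x ∷ y ∷ u ∷ []))

  UrelementsFormSet : Set ℓ
  UrelementsFormSet = ∃[ a ] IsSet a × (∀ x → x ∈ a ⇔ 𝒜 x)

  -- The right-to-left direction includes that ε depends only on the class and
  -- not on its presentation, i.e. that ε is a map on classes.
  BasicLawV : (Class → Carrier) → Set ℓ
  BasicLawV ε = ∀ X Y → (ε X ≡ ε Y) ⇔ (X ≈ᶜ Y)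

  Definable : (Class → Carrier) → Set ℓ
  Definable ε = Σ (Formula₂ 1 1) λ φ →
    ∀ X y → (ε X ≡ y) ⇔ Sat₂ φ (X ∷ []) (y ∷ [])

  ParametricallyDefinable : (Class → Carrier) → Set ℓ
  ParametricallyDefinable ε = Σ (Formula₂ 2 1) λ φ → Σ Class λ P →
    ∀ X y → (ε X ≡ y) ⇔ Sat₂ φ (X ∷ P ∷ []) (y ∷ [])

{-# OPTIONS --safe #-}
module Submission where

-- (1) ⇒ (2). The truth predicates for formulas of depth 0, 1, 2, … form a hierarchy T of
-- classes along ω, determined level by level by Tarski's clauses; every definable class is a
-- slice of some level. Let n be the least internal number such that a hierarchy reaches level n
-- and X is a slice of level n, and let εX be n together with the set of all slice parameters of
-- least rank (Scott's trick, available since the urelements form a set). Hierarchies agree where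
-- both are defined, so nothing depends on whether n is standard.
--
-- (3) ⇒ (1). Suppose the urelements are not a set, let A be the transitive closure of the
-- parameter, and use DC to pick disjoint pairs ⟨aₙ , bₙ⟩ of urelements outside A. The class X of
-- all t with aₙ ∈ t and bₙ ∉ t for almost all n is invariant under every transposition of
-- urelements outside A, hence so is εX. As the urelements are not a set, all urelements in the
-- transitive closure of εX then lie in A, so εX is fixed by the permutation that swaps every
-- aₙ with bₙ. But that permutation moves X.

open import Defs
open import Axiom.ExcludedMiddle using (ExcludedMiddle)
open import Data.Empty using (⊥; ⊥-elim)
open import Data.Fin using (Fin; zero; suc; inject₁; _↑ˡ_; _↑ʳ_)
open import Data.Fin.Patterns using (0F; 1F; 2F; 3F; 4F)
open import Data.Nat using (ℕ; zero; suc; _+_; _≤_; _<_; s≤s; _⊔_)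
open import Data.Nat.Properties using (_≟_; ≤-refl; ≤-trans; m≤m⊔n; m≤n⊔m; <⇒≢; n<1+n; m<n⇒m<1+n)
open import Data.Product using (Σ; ∃-syntax; ∃!; _×_; _,_; proj₁; proj₂)
open import Data.Sum using (_⊎_; inj₁; inj₂; [_,_]′)
open import Data.Unit using (⊤; tt)
open import Data.Vec using (Vec; []; _∷_; lookup; head; tail; map; _++_)
open import Data.Vec.Properties using (lookup-++ˡ; lookup-++ʳ; lookup-map)
open import Data.Product.Function.NonDependent.Propositional using (_×-⇔_)
open import Function.Base using (_∘_; id)
open import Function.Bundles using (_⇔_; mk⇔; Equivalence)
open import Function.Properties.Equivalence using () renaming (refl to ⇔-refl; sym to ⇔-sym; trans to ⇔-trans)
open import Function.Related.TypeIsomorphisms using (¬-cong-⇔)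
open import Level using (Level) renaming (suc to lsuc)
open import Relation.Binary.PropositionalEquality using (_≡_; _≢_; refl; sym; trans; cong; cong₂; subst; subst₂)
open import Relation.Nullary using (¬_; Dec; yes; no)
open import Relation.Nullary.Decidable using (False; toWitnessFalse; decidable-stable)
open Equivalence using (to; from)

-- By Tarski's theorem truth in U is not definable over U, so no single first-order formula decodes
-- all definable classes. Truth up to a fixed depth is definable, and a class quantifier can reach a
-- suitable truth class T without naming it. Hence εX is defined by "there is a T such that ...",
-- and the burden is to show that the outcome depends neither on T nor on the presentation of X. For
-- the converse, the contrast is between objects and classes: an object involves only a set of
-- urelements, those in its transitive closure, and is fixed as soon as these are; a class has no
-- such bound. The class X ignores each single transposition but detects infinitely many of them
-- together, and the pairs are ordered so that swapping their components is visible. The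
-- permutations are coded by sets of U, because they are extended to all objects by ∈-recursion
-- inside U. As ω may be nonstandard, internal induction applies to definable properties only; this
-- is why the proof keeps track of definability throughout.

module Proof {ℓ : Level} (em : ExcludedMiddle ℓ) (U : Structure ℓ) (zf : ZFUR U) (dc : DCScheme U) where
  open Structure U

  -- Definability

  ⇔-∃ : ∀ {a b c} {I : Set a} {A : I → Set b} {B : I → Set c} →
        (∀ i → A i ⇔ B i) → (Σ I A) ⇔ (Σ I B)
  ⇔-∃ e = mk⇔ (λ (i , a) → i , to (e i) a) (λ (i , b) → i , from (e i) b)

  stable : {A : Set ℓ} → ¬ ¬ A → A
  stable = decidable-stable em

  Renames : ∀ {n m} → (Fin n → Fin m) → Vec Carrier n → Vec Carrier m → Set ℓ
  Renames r ρ ρ' = ∀ i → lookup ρ' (r i) ≡ lookup ρ i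

  lift : ∀ {n m} → (Fin n → Fin m) → Fin (suc n) → Fin (suc m)
  lift r zero    = zero
  lift r (suc i) = suc (r i)

  lift-renames : ∀ {n m} {r : Fin n → Fin m} {ρ ρ'} x → Renames r ρ ρ' → Renames (lift r) (x ∷ ρ) (x ∷ ρ')
  lift-renames x R zero    = refl
  lift-renames x R (suc i) = R i

  rename : ∀ {n m} → (Fin n → Fin m) → Formula n → Formula m
  rename r (i ≐ j) = r i ≐ r j
  rename r (i ∈̇ j) = r i ∈̇ r j
  rename r (𝒜̇ i)   = 𝒜̇ (r i)
  rename r (¬̇ φ)   = ¬̇ rename r φ
  rename r (φ ∧̇ ψ) = rename r φ ∧̇ rename r ψ
  rename r (∃̇ φ)   = ∃̇ rename (lift r) φ

  rename-sat : ∀ {n m} (r : Fin n → Fin m) φ {ρ ρ'} → Renames r ρ ρ' →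
               Sat U (rename r φ) ρ' ⇔ Sat U φ ρ
  rename-sat r (i ≐ j) R rewrite R i | R j = ⇔-refl
  rename-sat r (i ∈̇ j) R rewrite R i | R j = ⇔-refl
  rename-sat r (𝒜̇ i)   R rewrite R i = ⇔-refl
  rename-sat r (¬̇ φ)   R = ¬-cong-⇔ (rename-sat r φ R)
  rename-sat r (φ ∧̇ ψ) R = _×-⇔_ (rename-sat r φ R) (rename-sat r ψ R)
  rename-sat r (∃̇ φ)   R = ⇔-∃ λ x → rename-sat (lift r) φ (lift-renames x R)

  -- Formulas indexed by their meaning, so that ordinary Agda propositions can be
  -- recognised as definable; `fun` makes definable functions available as terms.
  data Tm (k : ℕ) : (n : ℕ) → (Vec (Class U) k → Vec Carrier n → Carrier) → Set (lsuc ℓ)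
  data Fm (k : ℕ) : (n : ℕ) → (Vec (Class U) k → Vec Carrier n → Set ℓ) → Set (lsuc ℓ)

  data Tm k where
    var : ∀ {n} (i : Fin n) → Tm k n (λ _ ρ → lookup ρ i)
    wk  : ∀ {n f} → Tm k n f → Tm k (suc n) (λ Γ ρ → f Γ (tail ρ))
    fun : ∀ {n f P} → Fm k (suc n) P → (∀ Γ ρ y → P Γ (y ∷ ρ) ⇔ (y ≡ f Γ ρ)) → Tm k n f

  infix  8 _≐′_ _∈′_ _∈ᶜ′_
  infix  7 ¬′_
  infixr 6 _∧′_
  infixr 5 _∨′_
  infixr 4 _⇒′_ _⇔′_

  data Fm k where
    _≐′_  : ∀ {n f g} → Tm k n f → Tm k n g → Fm k n (λ Γ ρ → f Γ ρ ≡ g Γ ρ)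
    _∈′_  : ∀ {n f g} → Tm k n f → Tm k n g → Fm k n (λ Γ ρ → f Γ ρ ∈ g Γ ρ)
    𝒜′    : ∀ {n f} → Tm k n f → Fm k n (λ Γ ρ → 𝒜 (f Γ ρ))
    _∈ᶜ′_ : ∀ {n f} → Tm k n f → (j : Fin k) → Fm k n (λ Γ ρ → _∈ᶜ_ U (f Γ ρ) (lookup Γ j))
    ¬′_   : ∀ {n P} → Fm k n P → Fm k n (λ Γ ρ → ¬ P Γ ρ)
    _∧′_  : ∀ {n P Q} → Fm k n P → Fm k n Q → Fm k n (λ Γ ρ → P Γ ρ × Q Γ ρ)
    ∃′    : ∀ {n P} → Fm k (suc n) P → Fm k n (λ Γ ρ → ∃[ x ] P Γ (x ∷ ρ))
    by    : ∀ {n P Q} → Fm k n P → (∀ Γ ρ → P Γ ρ ⇔ Q Γ ρ) → Fm k n Q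
    ren   : ∀ {n m P} (r : Fin n → Fin m) (g : Vec Carrier m → Vec Carrier n) →
            (∀ ρ → Renames r (g ρ) ρ) → Fm k n P → Fm k m (λ Γ ρ → P Γ (g ρ))

  opaque
    _∨′_ : ∀ {k n P Q} → Fm k n P → Fm k n Q → Fm k n (λ Γ ρ → P Γ ρ ⊎ Q Γ ρ)
    _∨′_ {P = P} {Q} φ ψ = by (¬′ (¬′ φ ∧′ ¬′ ψ)) λ Γ ρ → mk⇔
      (λ h → stable λ n → h ((n ∘ inj₁) , (n ∘ inj₂)))
      (λ { (inj₁ p) (np , _) → np p ; (inj₂ q) (_ , nq) → nq q })

  opaque
    _⇒′_ : ∀ {k n P Q} → Fm k n P → Fm k n Q → Fm k n (λ Γ ρ → P Γ ρ → Q Γ ρ)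
    φ ⇒′ ψ = by (¬′ (φ ∧′ ¬′ ψ)) λ Γ ρ → mk⇔
      (λ h p → stable λ nq → h (p , nq)) (λ h (p , nq) → nq (h p))

  opaque
    _⇔′_ : ∀ {k n P Q} → Fm k n P → Fm k n Q → Fm k n (λ Γ ρ → P Γ ρ ⇔ Q Γ ρ)
    φ ⇔′ ψ = by ((φ ⇒′ ψ) ∧′ (ψ ⇒′ φ)) λ Γ ρ → mk⇔
      (λ (a , b) → mk⇔ a b) (λ e → to e , from e)

  opaque
    ∀′ : ∀ {k n P} → Fm k (suc n) P → Fm k n (λ Γ ρ → ∀ x → P Γ (x ∷ ρ))
    ∀′ φ = by (¬′ ∃′ (¬′ φ)) λ Γ ρ → mk⇔
      (λ h x → stable λ np → h (x , np)) (λ h (x , np) → np (h x))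

  -- Translation of the indexed syntax into formulas

  cons : ∀ {n m} → Fin m → (Fin n → Fin m) → Fin (suc n) → Fin m
  cons y r zero    = y
  cons y r (suc i) = r i

  +1 : ∀ {n m} → (Fin n → Fin m) → Fin n → Fin (suc m)
  +1 r i = suc (r i)

  -- The target language has no terms, so a term is replaced by the formula saying that the variable
  -- y holds its value. Carrying the renaming r along avoids weakening formulas that are already
  -- compiled.
  graph   : ∀ {k n m f} → Tm k n f → (Fin n → Fin m) → Fin m → Formula₂ k m
  compile : ∀ {k n m P} → Fm k n P → (Fin n → Fin m) → Formula₂ k m

  graph (var i)   r y = y ≐ r i
  graph (wk t)    r y = graph t (r ∘ suc) y
  graph (fun φ _) r y = compile φ (cons y r)

  compile (t ≐′ u)      r = ∃̇ (graph t (+1 r) zero ∧̇ graph u (+1 r) zero)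
  compile (t ∈′ u)      r = ∃̇ ∃̇ (graph t (+1 (+1 r)) (suc zero) ∧̇ graph u (+1 (+1 r)) zero ∧̇ (suc zero ∈̇ zero))
  compile (𝒜′ t)        r = ∃̇ (graph t (+1 r) zero ∧̇ 𝒜̇ zero)
  compile (t ∈ᶜ′ j)     r = ∃̇ (graph t (+1 r) zero ∧̇ (zero ∈̂ j))
  compile (¬′ φ)        r = ¬̇ compile φ r
  compile (φ ∧′ ψ)      r = compile φ r ∧̇ compile ψ r
  compile (∃′ φ)        r = ∃̇ compile φ (lift r)
  compile (by φ _)      r = compile φ r
  compile (ren s _ _ φ) r = compile φ (r ∘ s)

  cons-renames : ∀ {n m} {r : Fin n → Fin m} {ρ ρ'} y → Renames r ρ ρ' →
                 Renames (cons y r) (lookup ρ' y ∷ ρ) ρ'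
  cons-renames y R zero    = refl
  cons-renames y R (suc i) = R i

  graph-sat : ∀ {k n m f} (t : Tm k n f) (r : Fin n → Fin m) y Γ {ρ ρ'} → Renames r ρ ρ' →
              Sat₂ U (graph t r y) Γ ρ' ⇔ (lookup ρ' y ≡ f Γ ρ)
  compile-sat : ∀ {k n m P} (φ : Fm k n P) (r : Fin n → Fin m) Γ {ρ ρ'} → Renames r ρ ρ' →
                Sat₂ U (compile φ r) Γ ρ' ⇔ P Γ ρ

  graph-sat (var i)   r y Γ R rewrite R i = ⇔-refl
  graph-sat (wk t)    r y Γ {x ∷ ρ} R = graph-sat t (r ∘ suc) y Γ (R ∘ suc)
  graph-sat (fun φ e) r y Γ {ρ} {ρ'} R =
    ⇔-trans (compile-sat φ (cons y r) Γ (cons-renames {r = r} {ρ} {ρ'} y R)) (e Γ ρ (lookup ρ' y))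

  compile-sat (t ≐′ u) r Γ {ρ} {ρ'} R = mk⇔
    (λ (x , a , b) → trans (sym (to (T x) a)) (to (V x) b))
    (λ e → _ , from (T _) refl , from (V _) e)
    where
    T = λ x → graph-sat t (+1 r) zero Γ {ρ' = x ∷ ρ'} R
    V = λ x → graph-sat u (+1 r) zero Γ {ρ' = x ∷ ρ'} R
  compile-sat (t ∈′ u) r Γ {ρ} {ρ'} R = mk⇔
    (λ (x , y , a , b , c) → subst₂ _∈_ (to (T x y) a) (to (V x y) b) c)
    (λ e → _ , _ , from (T _ _) refl , from (V _ _) refl , e)
    where
    T = λ x y → graph-sat t (+1 (+1 r)) (suc zero) Γ {ρ' = y ∷ x ∷ ρ'} R
    V = λ x y → graph-sat u (+1 (+1 r)) zero Γ {ρ' = y ∷ x ∷ ρ'} R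
  compile-sat (𝒜′ t) r Γ {ρ} {ρ'} R = mk⇔
    (λ (x , a , b) → subst 𝒜 (to (T x) a) b)
    (λ e → _ , from (T _) refl , e)
    where T = λ x → graph-sat t (+1 r) zero Γ {ρ' = x ∷ ρ'} R
  compile-sat (t ∈ᶜ′ j) r Γ {ρ} {ρ'} R = mk⇔
    (λ (x , a , b) → subst (λ v → _∈ᶜ_ U v (lookup Γ j)) (to (T x) a) b)
    (λ e → _ , from (T _) refl , e)
    where T = λ x → graph-sat t (+1 r) zero Γ {ρ' = x ∷ ρ'} R
  compile-sat (¬′ φ)   r Γ R = ¬-cong-⇔ (compile-sat φ r Γ R)
  compile-sat (φ ∧′ ψ) r Γ R = _×-⇔_ (compile-sat φ r Γ R) (compile-sat ψ r Γ R)
  compile-sat (∃′ φ)   r Γ R = ⇔-∃ λ x → compile-sat φ (lift r) Γ (lift-renames x R)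
  compile-sat (by φ e) r Γ {ρ} R = ⇔-trans (compile-sat φ r Γ R) (e Γ ρ)
  compile-sat (ren s g S φ) r Γ {ρ} R = compile-sat φ (r ∘ s) Γ λ i → trans (R (s i)) (S ρ i)

  -- Separation, Replacement, the DC-scheme and presentations of classes accept first-order formulas
  -- only. A second-order formula without class quantifiers becomes first-order once its class
  -- variables are replaced by definitions.
  NoClassQuantifier : ∀ {k n} → Formula₂ k n → Set
  NoClassQuantifier (i ≐ j) = ⊤
  NoClassQuantifier (i ∈̇ j) = ⊤
  NoClassQuantifier (𝒜̇ i)   = ⊤
  NoClassQuantifier (i ∈̂ j) = ⊤
  NoClassQuantifier (¬̇ φ)   = NoClassQuantifier φ
  NoClassQuantifier (φ ∧̇ ψ) = NoClassQuantifier φ × NoClassQuantifier ψ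
  NoClassQuantifier (∃̇ φ)   = NoClassQuantifier φ
  NoClassQuantifier (∃̂ φ)   = ⊥

  graph-ncq : ∀ {k n m f} (t : Tm k n f) (r : Fin n → Fin m) y → NoClassQuantifier (graph t r y)
  compile-ncq : ∀ {k n m P} (φ : Fm k n P) (r : Fin n → Fin m) → NoClassQuantifier (compile φ r)

  graph-ncq (var i)   r y = tt
  graph-ncq (wk t)    r y = graph-ncq t (r ∘ suc) y
  graph-ncq (fun φ _) r y = compile-ncq φ (cons y r)

  compile-ncq (t ≐′ u)      r = graph-ncq t _ _ , graph-ncq u _ _
  compile-ncq (t ∈′ u)      r = graph-ncq t _ _ , graph-ncq u _ _ , tt
  compile-ncq (𝒜′ t)        r = graph-ncq t _ _ , tt
  compile-ncq (t ∈ᶜ′ j)     r = graph-ncq t _ _ , tt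
  compile-ncq (¬′ φ)        r = compile-ncq φ r
  compile-ncq (φ ∧′ ψ)      r = compile-ncq φ r , compile-ncq ψ r
  compile-ncq (∃′ φ)        r = compile-ncq φ (lift r)
  compile-ncq (by φ _)      r = compile-ncq φ r
  compile-ncq (ren s _ _ φ) r = compile-ncq φ (r ∘ s)

  pick : ∀ {n} → Fin n → Fin n → Fin 2 → Fin n
  pick i j zero       = i
  pick i j (suc zero) = j

  -- Replaces the class variable j by the class defined by ψ_j, with its parameter
  -- in the object variable q j.
  firstOrder : ∀ {k n m} (φ : Formula₂ k n) → NoClassQuantifier φ → Vec (Class U) k →
               (Fin n → Fin m) → (Fin k → Fin m) → Formula m
  firstOrder (i ≐ j) c Γ r q = r i ≐ r j
  firstOrder (i ∈̇ j) c Γ r q = r i ∈̇ r j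
  firstOrder (𝒜̇ i)   c Γ r q = 𝒜̇ (r i)
  firstOrder (i ∈̂ j) c Γ r q = rename (pick (r i) (q j)) (Class.ψ (lookup Γ j))
  firstOrder (¬̇ φ)   c Γ r q = ¬̇ firstOrder φ c Γ r q
  firstOrder (φ ∧̇ ψ) (c , d) Γ r q = firstOrder φ c Γ r q ∧̇ firstOrder ψ d Γ r q
  firstOrder (∃̇ φ)   c Γ r q = ∃̇ firstOrder φ c Γ (lift r) (+1 q)

  firstOrder-sat : ∀ {k n m} (φ : Formula₂ k n) c Γ (r : Fin n → Fin m) q {ρ ρ'} →
    Renames r ρ ρ' → (∀ j → lookup ρ' (q j) ≡ Class.z (lookup Γ j)) →
    Sat U (firstOrder φ c Γ r q) ρ' ⇔ Sat₂ U φ Γ ρ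
  firstOrder-sat (i ≐ j) c Γ r q R Q rewrite R i | R j = ⇔-refl
  firstOrder-sat (i ∈̇ j) c Γ r q R Q rewrite R i | R j = ⇔-refl
  firstOrder-sat (𝒜̇ i)   c Γ r q R Q rewrite R i = ⇔-refl
  firstOrder-sat (i ∈̂ j) c Γ r q R Q = rename-sat (pick (r i) (q j)) (Class.ψ (lookup Γ j))
    λ { zero → R i ; (suc zero) → Q j }
  firstOrder-sat (¬̇ φ)   c Γ r q R Q = ¬-cong-⇔ (firstOrder-sat φ c Γ r q R Q)
  firstOrder-sat (φ ∧̇ ψ) (c , d) Γ r q R Q =
    _×-⇔_ (firstOrder-sat φ c Γ r q R Q) (firstOrder-sat ψ d Γ r q R Q)
  firstOrder-sat (∃̇ φ)   c Γ r q R Q =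
    ⇔-∃ λ x → firstOrder-sat φ c Γ (lift r) (+1 q) (lift-renames x R) Q

  params : ∀ {k} → Vec (Class U) k → Vec Carrier k
  params = map Class.z

  formula : ∀ {k n P} → Fm k n P → Vec (Class U) k → Formula (n + k)
  formula {k} {n} φ Γ = firstOrder (compile φ id) (compile-ncq φ id) Γ (_↑ˡ k) (n ↑ʳ_)

  -- The bridge by which the schemata are applied to Agda propositions. Each class in Γ contributes
  -- its defining formula and, at the end of the environment, its parameter.
  formula-sat : ∀ {k n P} (φ : Fm k n P) Γ ρ → Sat U (formula φ Γ) (ρ ++ params Γ) ⇔ P Γ ρ
  formula-sat φ Γ ρ = ⇔-trans
    (firstOrder-sat (compile φ id) (compile-ncq φ id) Γ _ _ {ρ} {ρ ++ params Γ}
      (lookup-++ˡ ρ (params Γ))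
      (λ j → trans (lookup-++ʳ ρ (params Γ) j) (lookup-map j Class.z Γ)))
    (compile-sat φ id Γ {ρ} {ρ} λ _ → refl)

  -- Sets

  open ZFUR zf

  infix 4 _⊆_
  _⊆_ : Carrier → Carrier → Set ℓ
  x ⊆ y = ∀ w → w ∈ x → w ∈ y

  Trans : Carrier → Set ℓ
  Trans t = ∀ x → x ∈ t → x ⊆ t

  nonempty⇒set : ∀ {x y} → x ∈ y → IsSet U y
  nonempty⇒set x∈y a = urelements _ a _ x∈y

  ⊆-antisym : ∀ {x y} → IsSet U x → IsSet U y → x ⊆ y → y ⊆ x → x ≡ y
  ⊆-antisym sx sy a b = extensionality _ _ sx sy λ w → mk⇔ (a w) (b w)

  opaque
    pr : Carrier → Carrier → Carrier
    pr a b = proj₁ (pairing a b)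

    pr-set : ∀ {a b} → IsSet U (pr a b)
    pr-set {a} {b} = proj₁ (proj₂ (pairing a b))

    ∈pr : ∀ {a b w} → w ∈ pr a b ⇔ (w ≡ a ⊎ w ≡ b)
    ∈pr {a} {b} {w} = proj₂ (proj₂ (pairing a b)) w

    ⋃ : Carrier → Carrier
    ⋃ x = proj₁ (union x)

    ⋃-set : ∀ {x} → IsSet U (⋃ x)
    ⋃-set {x} = proj₁ (proj₂ (union x))

    ∈⋃ : ∀ {x w} → w ∈ ⋃ x ⇔ (∃[ y ] y ∈ x × w ∈ y)
    ∈⋃ {x} {w} = proj₂ (proj₂ (union x)) w

    𝒫 : Carrier → Carrier
    𝒫 x = proj₁ (powerset x)

    𝒫-set : ∀ {x} → IsSet U (𝒫 x)
    𝒫-set {x} = proj₁ (proj₂ (powerset x))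

    ∈𝒫 : ∀ {x w} → w ∈ 𝒫 x ⇔ (IsSet U w × w ⊆ x)
    ∈𝒫 {x} {w} = proj₂ (proj₂ (powerset x)) w

    ∅ : Carrier
    ∅ = proj₁ (proj₁ (proj₂ (proj₂ infinity)))

    ∅-set : IsSet U ∅
    ∅-set = proj₁ (proj₁ (proj₂ (proj₁ (proj₂ (proj₂ infinity)))))

    ∉∅ : ∀ {w} → ¬ w ∈ ∅
    ∉∅ = proj₂ (proj₁ (proj₂ (proj₁ (proj₂ (proj₂ infinity))))) _

    sep : ∀ {k n P} → Fm k (suc n) P → Vec (Class U) k → Vec Carrier n → Carrier → Carrier
    sep φ Γ ρ x = proj₁ (separation (formula φ Γ) (ρ ++ params Γ) x)

    sep-set : ∀ {k n P} {φ : Fm k (suc n) P} {Γ ρ x} → IsSet U (sep φ Γ ρ x)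
    sep-set {φ = φ} {Γ} {ρ} {x} = proj₁ (proj₂ (separation (formula φ Γ) (ρ ++ params Γ) x))

    ∈sep : ∀ {k n P} {φ : Fm k (suc n) P} {Γ ρ x w} → w ∈ sep φ Γ ρ x ⇔ (w ∈ x × P Γ (w ∷ ρ))
    ∈sep {φ = φ} {Γ} {ρ} {x} {w} = ⇔-trans
      (proj₂ (proj₂ (separation (formula φ Γ) (ρ ++ params Γ) x)) w)
      (_×-⇔_ ⇔-refl (formula-sat φ Γ (w ∷ ρ)))

  ∅-unique : ∀ {x} → IsSet U x → (∀ w → ¬ w ∈ x) → x ≡ ∅
  ∅-unique sx h = ⊆-antisym sx ∅-set (λ w i → ⊥-elim (h w i)) (λ w i → ⊥-elim (∉∅ i))

  opaque
    infixl 6 _∪_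
    _∪_ : Carrier → Carrier → Carrier
    x ∪ y = ⋃ (pr x y)

    ∪-set : ∀ {x y} → IsSet U (x ∪ y)
    ∪-set = ⋃-set

    ∈∪ : ∀ {x y w} → w ∈ x ∪ y ⇔ (w ∈ x ⊎ w ∈ y)
    ∈∪ {x} {y} {w} = mk⇔
      (λ i → let (v , v∈ , w∈v) = to ∈⋃ i in case v v∈ w∈v)
      [ (λ i → from ∈⋃ (x , from ∈pr (inj₁ refl) , i)) , (λ i → from ∈⋃ (y , from ∈pr (inj₂ refl) , i)) ]′
      where
      case : ∀ v → v ∈ pr x y → w ∈ v → w ∈ x ⊎ w ∈ y
      case v v∈ w∈v with to ∈pr v∈
      ... | inj₁ refl = inj₁ w∈v
      ... | inj₂ refl = inj₂ w∈v

    sg : Carrier → Carrier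
    sg a = pr a a

    sg-set : ∀ {a} → IsSet U (sg a)
    sg-set = pr-set

    ∈sg : ∀ {a w} → w ∈ sg a ⇔ (w ≡ a)
    ∈sg = mk⇔ (λ i → [ id , id ]′ (to ∈pr i)) (λ e → from ∈pr (inj₁ e))

    S : Carrier → Carrier
    S x = x ∪ sg x

    S-set : ∀ {x} → IsSet U (S x)
    S-set = ∪-set

    ∈S : ∀ {x w} → w ∈ S x ⇔ (w ∈ x ⊎ w ≡ x)
    ∈S = mk⇔ (λ i → [ inj₁ , inj₂ ∘ to ∈sg ]′ (to ∈∪ i)) (λ e → from ∈∪ ([ inj₁ , inj₂ ∘ from ∈sg ]′ e))

    ⟨_,_⟩ : Carrier → Carrier → Carrier
    ⟨ a , b ⟩ = pr (sg a) (pr a b)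

    sg-inj : ∀ {a b} → sg a ≡ sg b → a ≡ b
    sg-inj e = to ∈sg (subst (_ ∈_) e (from ∈sg refl))

    isPair⇔ : ∀ {p a b} → IsPair U p a b ⇔ (p ≡ pr a b)
    isPair⇔ = mk⇔
      (λ (s , h) → extensionality _ _ s pr-set λ w → ⇔-trans (h w) (⇔-sym ∈pr))
      (λ { refl → pr-set , λ w → ∈pr })

    isOrderedPair⇔ : ∀ {p a b} → IsOrderedPair U p a b ⇔ (p ≡ ⟨ a , b ⟩)
    isOrderedPair⇔ = mk⇔
      (λ (x , y , hx , hy , hp) → trans (to isPair⇔ hp) (cong₂ pr (to isPair⇔ hx) (to isPair⇔ hy)))
      (λ { refl → _ , _ , from isPair⇔ refl , from isPair⇔ refl , from isPair⇔ refl })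

    ⟨⟩-injˡ : ∀ {a b c d} → ⟨ a , b ⟩ ≡ ⟨ c , d ⟩ → a ≡ c
    ⟨⟩-injˡ {a} {b} {c} {d} e with to ∈pr (subst (sg a ∈_) e (from ∈pr (inj₁ refl)))
    ... | inj₁ h = sg-inj h
    ... | inj₂ h = sym (to ∈sg (subst (c ∈_) (sym h) (from ∈pr (inj₁ refl))))

    ⟨⟩-injʳ : ∀ {a b c d} → ⟨ a , b ⟩ ≡ ⟨ c , d ⟩ → b ≡ d
    ⟨⟩-injʳ {a} {b} {c} {d} e with ⟨⟩-injˡ e
    ... | refl with to ∈pr (subst (pr a b ∈_) e (from ∈pr (inj₂ refl)))
                  | to ∈pr (subst (pr a d ∈_) (sym e) (from ∈pr (inj₂ refl)))
    ... | inj₂ h | _ with to ∈pr (subst (b ∈_) h (from ∈pr (inj₂ refl)))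
                        | to ∈pr (subst (d ∈_) (sym h) (from ∈pr (inj₂ refl)))
    ...   | inj₂ b≡d | _        = b≡d
    ...   | inj₁ _   | inj₂ d≡b = sym d≡b
    ...   | inj₁ b≡a | inj₁ d≡a = trans b≡a (sym d≡a)
    ⟨⟩-injʳ {a} {b} {c} {d} e | refl | inj₁ h | inj₁ h' = trans
      (to ∈sg (subst (b ∈_) h (from ∈pr (inj₂ refl))))
      (sym (to ∈sg (subst (d ∈_) h' (from ∈pr (inj₂ refl)))))
    ⟨⟩-injʳ {a} {b} {c} {d} e | refl | inj₁ h | inj₂ h' = trans
      (to ∈sg (subst (b ∈_) h (from ∈pr (inj₂ refl))))
      (sym (to ∈sg (subst (d ∈_) (trans h' h) (from ∈pr (inj₂ refl)))))

    -- The components of a Kuratowski pair lie two levels down, so `⋃ (⋃ r)` bounds domain and range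
    -- of r and Separation suffices to form them.
    fst∈⋃⋃ : ∀ {a b r} → ⟨ a , b ⟩ ∈ r → a ∈ ⋃ (⋃ r)
    fst∈⋃⋃ i = from ∈⋃ (_ , from ∈⋃ (_ , i , from ∈pr (inj₂ refl)) , from ∈pr (inj₁ refl))

    snd∈⋃⋃ : ∀ {a b r} → ⟨ a , b ⟩ ∈ r → b ∈ ⋃ (⋃ r)
    snd∈⋃⋃ i = from ∈⋃ (_ , from ∈⋃ (_ , i , from ∈pr (inj₂ refl)) , from ∈pr (inj₂ refl))

  isSuc⇔ : ∀ {y x} → IsSuc U y x ⇔ (y ≡ S x)
  isSuc⇔ = mk⇔
    (λ (s , h) → extensionality _ _ s S-set λ w → ⇔-trans (h w) (⇔-sym ∈S))
    (λ { refl → S-set , λ w → ∈S })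

  maps⇔ : ∀ {f x y} → Maps U f x y ⇔ (⟨ x , y ⟩ ∈ f)
  maps⇔ = mk⇔ (λ (p , h , i) → subst (_∈ _) (to isOrderedPair⇔ h) i)
              (λ i → _ , from isOrderedPair⇔ refl , i)

  opaque
    -- By Extensionality a set-valued function is definable as soon as membership in its values is.
    -- The membership formula stands under two binders, the candidate value y and its element w;
    -- hence the `wk (wk t)` in the uses.
    setT : ∀ {k n f Q} → Fm k (2 + n) Q → (∀ Γ ρ → IsSet U (f Γ ρ)) →
           (∀ Γ ρ y w → w ∈ f Γ ρ ⇔ Q Γ (w ∷ y ∷ ρ)) → Tm k n f
    setT φ s e = fun (¬′ 𝒜′ (var 0F) ∧′ ∀′ (var 0F ∈′ var 1F ⇔′ φ)) λ Γ ρ y → mk⇔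
      (λ (sy , h) → extensionality _ _ sy (s Γ ρ) λ w → ⇔-trans (h w) (⇔-sym (e Γ ρ y w)))
      (λ { refl → s Γ ρ , e Γ ρ y })

  opaque
    ∅ᵗ : ∀ {k n} → Tm k n (λ _ _ → ∅)
    ∅ᵗ = setT (¬′ var 0F ≐′ var 0F) (λ _ _ → ∅-set)
      λ _ _ _ _ → mk⇔ (λ i → ⊥-elim (∉∅ i)) (λ h → ⊥-elim (h refl))

  module _ {k n f g} (t : Tm k n f) (u : Tm k n g) where
    prᵗ : Tm k n (λ Γ ρ → pr (f Γ ρ) (g Γ ρ))
    prᵗ = setT (var 0F ≐′ wk (wk t) ∨′ var 0F ≐′ wk (wk u)) (λ _ _ → pr-set) λ _ _ _ _ → ∈pr

    infixl 9 _∪ᵗ_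
    _∪ᵗ_ : Tm k n (λ Γ ρ → f Γ ρ ∪ g Γ ρ)
    _∪ᵗ_ = setT (var 0F ∈′ wk (wk t) ∨′ var 0F ∈′ wk (wk u)) (λ _ _ → ∪-set) λ _ _ _ _ → ∈∪

    infix 5 _⊆′_
    _⊆′_ : Fm k n (λ Γ ρ → f Γ ρ ⊆ g Γ ρ)
    _⊆′_ = ∀′ (var 0F ∈′ wk t ⇒′ var 0F ∈′ wk u)

  module _ {k n f} (t : Tm k n f) where
    sgᵗ : Tm k n (λ Γ ρ → sg (f Γ ρ))
    sgᵗ = setT (var 0F ≐′ wk (wk t)) (λ _ _ → sg-set) λ _ _ _ _ → ∈sg

    Sᵗ : Tm k n (λ Γ ρ → S (f Γ ρ))
    Sᵗ = setT (var 0F ∈′ wk (wk t) ∨′ var 0F ≐′ wk (wk t)) (λ _ _ → S-set) λ _ _ _ _ → ∈S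

    ⋃ᵗ : Tm k n (λ Γ ρ → ⋃ (f Γ ρ))
    ⋃ᵗ = setT (∃′ (var 0F ∈′ wk (wk (wk t)) ∧′ var 1F ∈′ var 0F)) (λ _ _ → ⋃-set) λ _ _ _ _ → ∈⋃

    𝒫ᵗ : Tm k n (λ Γ ρ → 𝒫 (f Γ ρ))
    𝒫ᵗ = setT (¬′ 𝒜′ (var 0F) ∧′ (var 0F ⊆′ wk (wk t))) (λ _ _ → 𝒫-set) λ _ _ _ _ → ∈𝒫

    Trans′ : Fm k n (λ Γ ρ → Trans (f Γ ρ))
    Trans′ = ∀′ (var 0F ∈′ wk t ⇒′ (var 0F ⊆′ wk t))

  opaque
    unfolding ⟨_,_⟩

    ⟨_,_⟩ᵗ : ∀ {k n f g} → Tm k n f → Tm k n g → Tm k n (λ Γ ρ → ⟨ f Γ ρ , g Γ ρ ⟩)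
    ⟨ t , u ⟩ᵗ = prᵗ (sgᵗ t) (prᵗ t u)

  -- Definite description made total, so that it can be a term: d is the value both when nothing and
  -- when more than one thing satisfies P. For `swap` the default is essential, since it keeps
  -- unlinked objects in place.
  theElement : (Carrier → Set ℓ) → Carrier → Carrier
  theElement P d with em {∃[ y ] P y × (∀ y' → P y' → y' ≡ y)}
  ... | yes (y , _) = y
  ... | no _        = d

  theElement≡ : ∀ {P d y} → P y → (∀ y' → P y' → y' ≡ y) → theElement P d ≡ y
  theElement≡ {P} p u with em {∃[ y ] P y × (∀ y' → P y' → y' ≡ y)}
  ... | yes (y , q , v) = u _ q
  ... | no h            = ⊥-elim (h (_ , p , u))

  theElement-none : ∀ {P d} → (∀ y → ¬ P y) → theElement P d ≡ d
  theElement-none {P} h with em {∃[ y ] P y × (∀ y' → P y' → y' ≡ y)}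
  ... | yes (y , q , _) = ⊥-elim (h y q)
  ... | no _            = refl

  skip : ∀ {k n P} → Fm k (suc n) P → Fm k (suc (suc n)) (λ Γ ρ → P Γ (head ρ ∷ tail (tail ρ)))
  skip = ren (λ { zero → zero ; (suc i) → suc (suc i) }) (λ ρ → head ρ ∷ tail (tail ρ))
    λ { (x ∷ y ∷ ρ) zero → refl ; (x ∷ y ∷ ρ) (suc i) → refl }

  opaque
    theElementᵗ : ∀ {k n f P} → Fm k (suc n) P → Tm k n f →
                  Tm k n (λ Γ ρ → theElement (λ y → P Γ (y ∷ ρ)) (f Γ ρ))
    theElementᵗ {k} {n} {f} {P} φ t = fun
      (unique ∨′ ¬′ ∃′ (skip unique) ∧′ var 0F ≐′ wk t)
      λ Γ ρ y → mk⇔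
        [ (λ (p , u) → sym (theElement≡ p u)) , (λ (h , e) → trans e (sym (none h))) ]′
        (λ { refl → some })
      where
      unique : Fm k (suc n) (λ Γ ρ → P Γ (head ρ ∷ tail ρ) × (∀ y' → P Γ (y' ∷ tail ρ) → y' ≡ head ρ))
      unique = by (φ ∧′ ∀′ (skip φ ⇒′ var 0F ≐′ var 1F)) λ { Γ (x ∷ ρ) → ⇔-refl }
      none : ∀ {P : Carrier → Set ℓ} {d} → ¬ (∃[ y ] P y × (∀ y' → P y' → y' ≡ y)) → theElement P d ≡ d
      none {P} h with em {∃[ y ] P y × (∀ y' → P y' → y' ≡ y)}
      ... | yes q = ⊥-elim (h q)
      ... | no _  = refl
      some : ∀ {P : Carrier → Set ℓ} {d} →
        (P (theElement P d) × (∀ y' → P y' → y' ≡ theElement P d)) ⊎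
        (¬ (∃[ y ] P y × (∀ y' → P y' → y' ≡ y)) × theElement P d ≡ d)
      some {P} with em {∃[ y ] P y × (∀ y' → P y' → y' ≡ y)}
      ... | yes (y , q) = inj₁ q
      ... | no h        = inj₂ (h , refl)

  module _ {k n f} (t : Tm k (suc n) f) (Γ : Vec (Class U) k) (ρ : Vec Carrier n) (d : Carrier) where
    private
      φ : Fm k (suc (suc n)) (λ Γ ρ → head (tail ρ) ≡ f Γ (head ρ ∷ tail (tail ρ)))
      -- Replacement puts the argument x before the value y, whereas `var 0F ≐′ wk t` has the value
      -- in front; the renaming exchanges the two.
      φ = ren (λ { zero → 1F ; (suc zero) → 0F ; (suc (suc i)) → suc (suc i) })
              (λ ρ → head (tail ρ) ∷ head ρ ∷ tail (tail ρ))
              (λ { (x ∷ y ∷ ρ) zero → refl ; (x ∷ y ∷ ρ) (suc zero) → refl ; (x ∷ y ∷ ρ) (suc (suc i)) → refl })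
              (var 0F ≐′ wk t)

      φ-sat : ∀ x y → Sat U (formula φ Γ) (x ∷ y ∷ ρ ++ params Γ) ⇔ (y ≡ f Γ (x ∷ ρ))
      φ-sat x y = formula-sat φ Γ (x ∷ y ∷ ρ)

      opaque
        imageSet : ∃[ r ] IsSet U r × (∀ y → y ∈ r ⇔ (∃[ x ] x ∈ d × y ≡ f Γ (x ∷ ρ)))
        imageSet =
          let (r , s , h) = replacement (formula φ Γ) (ρ ++ params Γ) d λ x _ →
                f Γ (x ∷ ρ) , from (φ-sat x _) refl , λ e → sym (to (φ-sat x _) e)
          in r , s , λ y → ⇔-trans (h y) (⇔-∃ λ x → _×-⇔_ ⇔-refl (φ-sat x y))

    image : Carrier
    image = proj₁ imageSet

    image-set : IsSet U image
    image-set = proj₁ (proj₂ imageSet)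

    ∈image : ∀ {y} → y ∈ image ⇔ (∃[ x ] x ∈ d × y ≡ f Γ (x ∷ ρ))
    ∈image = proj₂ (proj₂ imageSet) _

  -- The internal ω and dependent choices along it

  Inductive : Carrier → Set ℓ
  Inductive s = ∅ ∈ s × (∀ x → x ∈ s → S x ∈ s)

  inductive⇔ : ∀ {s} → IsInductive U s ⇔ Inductive s
  inductive⇔ = mk⇔
    (λ ((e , (se , he) , e∈) , h) → subst (_∈ _) (∅-unique se he) e∈ ,
       λ x i → let (y , hy , y∈) = h x i in subst (_∈ _) (to isSuc⇔ hy) y∈)
    (λ (z , h) → (∅ , (∅-set , λ _ → ∉∅) , z) , λ x i → S x , from isSuc⇔ refl , h x i)

  opaque
    Inductive′ : ∀ {k n f} → Tm k n f → Fm k n (λ Γ ρ → Inductive (f Γ ρ))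
    Inductive′ t = ∅ᵗ ∈′ t ∧′ ∀′ (var 0F ∈′ wk t ⇒′ Sᵗ (var 0F) ∈′ wk t)

  opaque
    ω : Carrier
    ω = sep {k = 0} {n = 0} (∀′ (Inductive′ (var 0F) ⇒′ var 1F ∈′ var 0F)) [] [] (proj₁ infinity)

    ω-set : IsSet U ω
    ω-set = sep-set

    ∈ω : ∀ {n} → n ∈ ω ⇔ (∀ s → Inductive s → n ∈ s)
    ∈ω = mk⇔ (λ i → proj₂ (to ∈sep i))
      (λ h → from ∈sep (h _ (to inductive⇔ (proj₂ (proj₂ infinity))) , h))

  isOmega⇒≡ : ∀ {o} → IsOmega U o → o ≡ ω
  isOmega⇒≡ (s , h) = extensionality _ _ s ω-set λ w → ⇔-trans (h w) (⇔-trans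
    (mk⇔ (λ k s i → k s (from inductive⇔ i)) (λ k s i → k s (to inductive⇔ i))) (⇔-sym ∈ω))

  opaque
    ωᵗ : ∀ {k n} → Tm k n (λ _ _ → ω)
    ωᵗ = setT (∀′ (Inductive′ (var 0F) ⇒′ var 1F ∈′ var 0F)) (λ _ _ → ω-set) λ _ _ _ _ → ∈ω

  ∅∈ω : ∅ ∈ ω
  ∅∈ω = from ∈ω λ s → proj₁

  S∈ω : ∀ {n} → n ∈ ω → S n ∈ ω
  S∈ω i = from ∈ω λ s h → proj₂ h _ (to ∈ω i s h)

  -- Separation turns the property into an inductive subset of ω. This needs a definable property,
  -- so every use supplies its formula.
  ω-ind : ∀ {k n P} (φ : Fm k (suc n) P) Γ ρ → P Γ (∅ ∷ ρ) →
          (∀ x → x ∈ ω → P Γ (x ∷ ρ) → P Γ (S x ∷ ρ)) → ∀ x → x ∈ ω → P Γ (x ∷ ρ)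
  ω-ind φ Γ ρ z s x i = proj₂ (to ∈sep (to ∈ω i (sep φ Γ ρ ω)
    (from ∈sep (∅∈ω , z) ,
     λ y j → let (y∈ , p) = to ∈sep j in from ∈sep (S∈ω y∈ , s y y∈ p))))

  opaque
    dependentChoices : ∀ {R} (φ : Fm 0 3 R) u → (∀ x → ∃[ y ] R [] (x ∷ y ∷ u ∷ [])) → ∀ p →
      ∃[ s ] (∀ n → n ∈ ω → ∃! _≡_ λ v → ⟨ n , v ⟩ ∈ s) × ⟨ ∅ , p ⟩ ∈ s ×
        (∀ n → n ∈ ω → ∃[ x ] ∃[ y ] ⟨ n , x ⟩ ∈ s × ⟨ S n , y ⟩ ∈ s × R [] (x ∷ y ∷ u ∷ []))
    dependentChoices φ u total p
      with dc (formula φ []) u (λ x → let (y , r) = total x in y , from (formula-sat φ [] (x ∷ y ∷ u ∷ [])) r) p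
    ... | s , o , isω , (_ , _ , fn) , (e , (se , he) , start) , step with isOmega⇒≡ isω
    ...   | refl = s
      , (λ n i → let (v , m , un) = fn n i in v , to maps⇔ m , λ h → un (from maps⇔ h))
      , subst (λ e → ⟨ e , p ⟩ ∈ s) (∅-unique se he) (to maps⇔ start)
      , λ n i → let (m , x , y , sm , mx , my , r) = step n i in
          x , y , to maps⇔ mx , subst (λ m → ⟨ m , y ⟩ ∈ s) (to isSuc⇔ sm) (to maps⇔ my)
          , to (formula-sat φ [] (x ∷ y ∷ u ∷ [])) r

  opaque
    ∈range : ∀ {k} → Fm k 2 (λ _ ρ → ∃[ n ] n ∈ ω × ⟨ n , lookup ρ 0F ⟩ ∈ lookup ρ 1F)
    ∈range = ∃′ (var 0F ∈′ ωᵗ ∧′ ⟨ var 0F , var 1F ⟩ᵗ ∈′ var 2F)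

  opaque
    ⋃range : Carrier → Carrier
    ⋃range s = ⋃ (sep ∈range [] (s ∷ []) (⋃ (⋃ s)))

    ⋃range-set : ∀ {s} → IsSet U (⋃range s)
    ⋃range-set = ⋃-set

    ∈⋃range : ∀ {s w} → w ∈ ⋃range s ⇔ (∃[ n ] ∃[ v ] n ∈ ω × ⟨ n , v ⟩ ∈ s × w ∈ v)
    ∈⋃range = mk⇔
      (λ i → let (v , v∈ , w∈v) = to ∈⋃ i
                 (_ , n , n∈ω , nv) = to (∈sep {φ = ∈range}) v∈
             in n , v , n∈ω , nv , w∈v)
      (λ (n , v , n∈ω , nv , w∈v) → from ∈⋃ (v , from (∈sep {φ = ∈range}) (snd∈⋃⋃ nv , n , n∈ω , nv) , w∈v))

  opaque
    ⋃rangeᵗ : ∀ {k n f} → Tm k n f → Tm k n (λ Γ ρ → ⋃range (f Γ ρ))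
    ⋃rangeᵗ t = setT
      (∃′ (∃′ (var 1F ∈′ ωᵗ ∧′ ⟨ var 1F , var 0F ⟩ᵗ ∈′ wk (wk (wk (wk t))) ∧′ var 2F ∈′ var 0F)))
      (λ _ _ → ⋃range-set) λ _ _ _ _ → ∈⋃range

  -- Transitive closure and ∈-induction

  opaque
    transitiveSet∋ : ∀ x → ∃[ t ] Trans t × x ∈ t
    -- The relation is the graph of a function, so the DC-scheme merely iterates `x ∪ ⋃ x` along ω.
    -- Starting with `sg x` rather than x puts x itself into the result, even if x is a urelement.
    transitiveSet∋ x with dependentChoices (var 1F ≐′ (var 0F ∪ᵗ ⋃ᵗ (var 0F))) ∅ (λ x → x ∪ ⋃ x , refl) (sg x)
    ... | s , value , start , step = ⋃range s
      , (λ y y∈ w w∈y →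
          let (n , v , n∈ω , nv , y∈v) = to ∈⋃range y∈
              (v' , v″ , nv' , Snv″ , e) = step n n∈ω
              (_ , _ , un) = value n n∈ω
              y∈v' = subst (y ∈_) (trans (sym (un nv)) (un nv')) y∈v
          in from ∈⋃range (S n , v″ , S∈ω n∈ω , Snv″ ,
               subst (w ∈_) (sym e) (from ∈∪ (inj₂ (from ∈⋃ (y , y∈v' , w∈y))))))
      , from ∈⋃range (∅ , sg x , ∅∈ω , start , from ∈sg refl)

  -- Foundation speaks of sets only. A transitive set t around a witness reduces the class to a
  -- subset of t, and elements of members of t stay in t, so minimality there is minimality in the
  -- class.
  ∈-minimal : ∀ {k n P} (φ : Fm k (suc n) P) Γ ρ → ∃[ x ] P Γ (x ∷ ρ) →
              ∃[ x ] P Γ (x ∷ ρ) × (∀ y → y ∈ x → ¬ P Γ (y ∷ ρ))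
  ∈-minimal φ Γ ρ (x , p) =
    let (t , tr , x∈t) = transitiveSet∋ x
        (y , y∈ , h) = foundation (sep φ Γ ρ t) (x , from ∈sep (x∈t , p))
        (y∈t , q) = to ∈sep y∈
    in y , q , λ w w∈y r → h w (from ∈sep (tr y y∈t w w∈y , r)) w∈y

  ∈-ind : ∀ {k n P} (φ : Fm k (suc n) P) Γ ρ →
          (∀ x → (∀ y → y ∈ x → P Γ (y ∷ ρ)) → P Γ (x ∷ ρ)) → ∀ x → P Γ (x ∷ ρ)
  ∈-ind φ Γ ρ h x = stable λ np →
    let (y , nq , m) = ∈-minimal (¬′ φ) Γ ρ (x , np) in nq (h y λ w i → stable (m w i))

  opaque
    -- The transitive closure of {x} rather than of x: it contains x, hence is informative also when
    -- x is a urelement.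
    TC : Carrier → Carrier
    TC x = sep {k = 0} (∀′ (Trans′ (var 0F) ⇒′ var 2F ∈′ var 0F ⇒′ var 1F ∈′ var 0F)) [] (x ∷ [])
      (proj₁ (transitiveSet∋ x))

    TC-set : ∀ {x} → IsSet U (TC x)
    TC-set = sep-set

    ∈TC : ∀ {x w} → w ∈ TC x ⇔ (∀ t → Trans t → x ∈ t → w ∈ t)
    ∈TC {x} = mk⇔ (λ i → proj₂ (to ∈sep i)) λ h → let (t , tr , i) = transitiveSet∋ x in
      from ∈sep (h t tr i , h)

  opaque
    TCᵗ : ∀ {k n f} → Tm k n f → Tm k n (λ Γ ρ → TC (f Γ ρ))
    TCᵗ t = setT (∀′ (Trans′ (var 0F) ⇒′ wk (wk (wk t)) ∈′ var 0F ⇒′ var 1F ∈′ var 0F))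
      (λ _ _ → TC-set) λ _ _ _ _ → ∈TC

  ∈TC-refl : ∀ {x} → x ∈ TC x
  ∈TC-refl = from ∈TC λ t _ i → i

  TC-trans : ∀ {x} → Trans (TC x)
  TC-trans y y∈ w w∈y = from ∈TC λ t tr x∈t → tr y (to ∈TC y∈ t tr x∈t) w w∈y

  ∈-irrefl : ∀ {x} → ¬ x ∈ x
  ∈-irrefl {x} = ∈-ind {k = 0} (¬′ var 0F ∈′ var 0F) [] [] (λ x h i → h x i i) x

  ∈-asym : ∀ {x y} → x ∈ y → ¬ y ∈ x
  ∈-asym {x} {y} = λ i j → ∈-ind {k = 0} (∀′ (var 0F ∈′ var 1F ⇒′ ¬′ var 1F ∈′ var 0F)) [] []
    (λ x h y y∈x x∈y → h y y∈x x x∈y y∈x) x y j i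

  -- The order of ω

  S-inj : ∀ {x y} → S x ≡ S y → x ≡ y
  S-inj e with to ∈S (subst (_ ∈_) e (from ∈S (inj₂ refl))) | to ∈S (subst (_ ∈_) (sym e) (from ∈S (inj₂ refl)))
  ... | inj₂ p | _      = p
  ... | inj₁ _ | inj₂ q = sym q
  ... | inj₁ i | inj₁ j = ⊥-elim (∈-asym i j)

  ∅≢S : ∀ {x} → ∅ ≢ S x
  ∅≢S e = ∉∅ (subst (_ ∈_) (sym e) (from ∈S (inj₂ refl)))

  ω-transitive : ∀ {n} → n ∈ ω → Trans n
  ω-transitive {n} = ω-ind {k = 0} (Trans′ (var 0F)) [] []
    (λ x i → ⊥-elim (∉∅ i))
    (λ n _ h x i w w∈x → from ∈S (inj₁ ([ (λ x∈n → h x x∈n w w∈x) , (λ { refl → w∈x }) ]′ (to ∈S i)))) n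

  ⊆ω : ∀ {n} → n ∈ ω → n ⊆ ω
  ⊆ω {n} = ω-ind {k = 0} (var 0F ⊆′ ωᵗ) [] [] (λ x i → ⊥-elim (∉∅ i))
    (λ n n∈ω h x i → [ h x , (λ { refl → n∈ω }) ]′ (to ∈S i)) n

  ω-element-set : ∀ {n} → n ∈ ω → IsSet U n
  ω-element-set {n} = ω-ind {k = 0} (¬′ 𝒜′ (var 0F)) [] [] ∅-set (λ _ _ _ → S-set) n

  -- Induction on n, splitting on n ∈ m: if n is missing, then m is already included in n; if it is
  -- present, transitivity of m forces m ≡ S n.
  ⊆⇒∈S : ∀ {m n} → m ∈ ω → n ∈ ω → m ⊆ n → m ∈ S n
  ⊆⇒∈S {m} {n} m∈ω n∈ω = ω-ind {k = 0} (var 1F ⊆′ var 0F ⇒′ var 1F ∈′ Sᵗ (var 0F)) [] (m ∷ [])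
    (λ h → from ∈S (inj₂ (∅-unique (ω-element-set m∈ω) λ w i → ∉∅ (h w i))))
    (λ n n∈ω ih m⊆ → step n ih m⊆ em) n n∈ω
    where
    step : ∀ n → (m ⊆ n → m ∈ S n) → m ⊆ S n → Dec (n ∈ m) → m ∈ S (S n)
    step n ih m⊆ (no n∉m) = from ∈S (inj₁ (ih λ w w∈m →
      [ id , (λ { refl → ⊥-elim (n∉m w∈m) }) ]′ (to ∈S (m⊆ w w∈m))))
    step n ih m⊆ (yes n∈m) = from ∈S (inj₂ (⊆-antisym (ω-element-set m∈ω) S-set m⊆ λ w i →
      [ ω-transitive m∈ω n n∈m w , (λ { refl → n∈m }) ]′ (to ∈S i)))

  ∈⊎⊆ : ∀ {m n} → m ∈ ω → n ∈ ω → m ∈ n ⊎ n ⊆ m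
  ∈⊎⊆ {m} {n} m∈ω = ω-ind {k = 0} (var 1F ∈′ var 0F ∨′ (var 0F ⊆′ var 1F)) [] (m ∷ [])
    (inj₂ λ w i → ⊥-elim (∉∅ i))
    (λ n n∈ω → [ (λ i → inj₁ (from ∈S (inj₁ i)))
               , (λ h → [ (λ n∈m → inj₂ λ w i → [ h w , (λ { refl → n∈m }) ]′ (to ∈S i))
                        , (λ { refl → inj₁ (from ∈S (inj₂ refl)) }) ]′ (to ∈S (⊆⇒∈S n∈ω m∈ω h))) ]′)
    n

  ∈-trichotomy : ∀ {m n} → m ∈ ω → n ∈ ω → m ∈ n ⊎ m ≡ n ⊎ n ∈ m
  ∈-trichotomy m∈ω n∈ω with ∈⊎⊆ m∈ω n∈ω
  ... | inj₁ i = inj₁ i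
  ... | inj₂ h with to ∈S (⊆⇒∈S n∈ω m∈ω h)
  ...   | inj₁ i = inj₂ (inj₂ i)
  ...   | inj₂ e = inj₂ (inj₁ (sym e))

  -- ∈-recursion

  opaque
    img : Carrier → Carrier → Carrier
    img h x = sep {k = 0} (∃′ (var 0F ∈′ var 3F ∧′ ⟨ var 0F , var 1F ⟩ᵗ ∈′ var 2F)) [] (h ∷ x ∷ []) (⋃ (⋃ h))

    img-set : ∀ {h x} → IsSet U (img h x)
    img-set = sep-set

    ∈img : ∀ {h x v} → v ∈ img h x ⇔ (∃[ u ] u ∈ x × ⟨ u , v ⟩ ∈ h)
    ∈img = mk⇔ (λ i → proj₂ (to ∈sep i)) (λ (u , i , j) → from ∈sep (snd∈⋃⋃ j , u , i , j))

    imgᵗ : ∀ {k n f g} → Tm k n f → Tm k n g → Tm k n (λ Γ ρ → img (f Γ ρ) (g Γ ρ))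
    imgᵗ t u = setT (∃′ (var 0F ∈′ wk (wk (wk u)) ∧′ ⟨ var 0F , var 1F ⟩ᵗ ∈′ wk (wk (wk t))))
      (λ _ _ → img-set) λ _ _ _ _ → ∈img

  module Recursion
    (G : Carrier → Carrier → Carrier → Carrier)
    (Gᵗ : ∀ {k n f g h} → Tm k n f → Tm k n g → Tm k n h → Tm k n (λ Γ ρ → G (f Γ ρ) (g Γ ρ) (h Γ ρ)))
    where

    -- A partial solution whose domain is closed under elements. That it is single-valued is a
    -- consequence, by `attempt-unique` for h against itself.
    Attempt : Carrier → Carrier → Set ℓ
    Attempt p h = ∀ x y → ⟨ x , y ⟩ ∈ h → (∀ u → u ∈ x → ∃[ v ] ⟨ u , v ⟩ ∈ h) × y ≡ G p x (img h x)

    attempt-unique : ∀ {p h h'} → Attempt p h → Attempt p h' →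
                     ∀ x y y' → ⟨ x , y ⟩ ∈ h → ⟨ x , y' ⟩ ∈ h' → y ≡ y'
    attempt-unique {p} {h} {h'} A A' = ∈-ind {k = 0}
      (∀′ (∀′ (⟨ var 2F , var 1F ⟩ᵗ ∈′ var 3F ⇒′ ⟨ var 2F , var 0F ⟩ᵗ ∈′ var 4F ⇒′ var 1F ≐′ var 0F)))
      [] (h ∷ h' ∷ []) λ x ih y y' i i' →
        let (d , e) = A x y i
            (d' , e') = A' x y' i'
            img≡ : img h x ≡ img h' x
            img≡ = ⊆-antisym img-set img-set
              (λ v j → let (u , u∈x , uv) = to ∈img j ; (v' , uv') = d' u u∈x in
                from ∈img (u , u∈x , subst (λ v → ⟨ u , v ⟩ ∈ h') (sym (ih u u∈x v v' uv uv')) uv'))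
              (λ v j → let (u , u∈x , uv) = to ∈img j ; (v' , uv') = d u u∈x in
                from ∈img (u , u∈x , subst (λ v → ⟨ u , v ⟩ ∈ h) (ih u u∈x v' v uv' uv) uv'))
        in trans e (trans (cong (G p x) img≡) (sym e'))

    Value : Carrier → Carrier → Carrier → Set ℓ
    Value p x y = ∃[ h ] Attempt p h × ⟨ x , y ⟩ ∈ h

    value-unique : ∀ {p x y y'} → Value p x y → Value p x y' → y ≡ y'
    value-unique (h , A , i) (h' , A' , i') = attempt-unique A A' _ _ _ i i'

    opaque
      Attempt′ : ∀ {k n f g} → Tm k n f → Tm k n g → Fm k n (λ Γ ρ → Attempt (f Γ ρ) (g Γ ρ))
      Attempt′ t u = ∀′ (∀′ (⟨ var 1F , var 0F ⟩ᵗ ∈′ wk (wk u) ⇒′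
        (∀′ (var 0F ∈′ var 2F ⇒′ ∃′ (⟨ var 1F , var 0F ⟩ᵗ ∈′ wk (wk (wk (wk u))))) ∧′
         var 0F ≐′ Gᵗ (wk (wk t)) (var 1F) (imgᵗ (wk (wk u)) (var 1F)))))

      Value′ : ∀ {k n f g h} → Tm k n f → Tm k n g → Tm k n h → Fm k n (λ Γ ρ → Value (f Γ ρ) (g Γ ρ) (h Γ ρ))
      Value′ t u v = ∃′ (Attempt′ (wk t) (var 0F) ∧′ ⟨ wk u , wk v ⟩ᵗ ∈′ var 0F)

      F : Carrier → Carrier → Carrier
      F p x = theElement (Value p x) ∅

      F≡ : ∀ {p x y} → Value p x y → F p x ≡ y
      F≡ v = theElement≡ v λ y' v' → value-unique v' v

      Fᵗ : ∀ {k n f g} → Tm k n f → Tm k n g → Tm k n (λ Γ ρ → F (f Γ ρ) (g Γ ρ))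
      Fᵗ t u = theElementᵗ (Value′ (wk t) (wk u) (var 0F)) ∅ᵗ

    HasValue : Carrier → Carrier → Set ℓ
    HasValue p x = ∃[ y ] Value p x y

    F-value : ∀ {p x} → HasValue p x → Value p x (F p x)
    F-value (y , v) = subst (Value _ _) (sym (F≡ v)) v

    hasValue-∈ : ∀ {p x u} → HasValue p x → u ∈ x → HasValue p u
    hasValue-∈ (y , h , A , i) u∈x = let (v , j) = proj₁ (A _ _ i) _ u∈x in v , h , A , j

    private
      φ : ∀ {k n} → Fm k (2 + n) (λ Γ ρ → HasValue (lookup ρ 1F) (lookup ρ 0F))
      φ = ∃′ (Value′ (var 2F) (var 1F) (var 0F))

    -- The graph of F on the part of TC x where F has a value, extended by x, is an attempt.
    extend : ∀ p x → ¬ HasValue p x → (∀ u → u ∈ x → HasValue p u) → HasValue p x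
    extend p x nx hv = G p x (img H x) , H , H-attempt , from ∈∪ (inj₂ (from ∈sg (cong ⟨ x ,_⟩ (cong (G p x) img≡))))
      where
      d = sep φ [] (p ∷ []) (TC x)
      pairᵗ : Tm 0 2 (λ Γ ρ → ⟨ lookup ρ 0F , F (lookup ρ 1F) (lookup ρ 0F) ⟩)
      pairᵗ = ⟨ var 0F , Fᵗ (var 1F) (var 0F) ⟩ᵗ
      H₀ = image pairᵗ [] (p ∷ []) d
      H = H₀ ∪ sg ⟨ x , G p x (img H₀ x) ⟩
      ∈H₀ : ∀ {u v} → ⟨ u , v ⟩ ∈ H₀ ⇔ (u ∈ TC x × Value p u v)
      ∈H₀ {u} {v} = mk⇔
        (λ i → let (u' , u'∈ , e) = to (∈image pairᵗ [] (p ∷ []) d) i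
                   (j , hv) = to (∈sep {φ = φ}) u'∈
               in subst (_∈ TC x) (sym (⟨⟩-injˡ e)) j
                , subst₂ (Value p) (sym (⟨⟩-injˡ e)) (sym (⟨⟩-injʳ e)) (F-value hv))
        (λ (i , w) → from (∈image pairᵗ [] (p ∷ []) d)
           (u , from (∈sep {φ = φ}) (i , v , w) , cong ⟨ u ,_⟩ (sym (F≡ w))))
      ∈H : ∀ {u v} → u ≢ x → ⟨ u , v ⟩ ∈ H → ⟨ u , v ⟩ ∈ H₀
      ∈H u≢x i = [ id , (λ j → ⊥-elim (u≢x (⟨⟩-injˡ (to ∈sg j)))) ]′ (to ∈∪ i)
      img≡ : img H x ≡ img H₀ x
      img≡ = ⊆-antisym img-set img-set
        (λ v j → let (u , u∈x , uv) = to ∈img j in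
          from ∈img (u , u∈x , ∈H (λ e → ∈-irrefl (subst (_∈ x) e u∈x)) uv))
        (λ v j → let (u , u∈x , uv) = to ∈img j in from ∈img (u , u∈x , from ∈∪ (inj₁ uv)))
      H-attempt : Attempt p H
      H-attempt u v uv with to ∈∪ uv
      ... | inj₂ i with ⟨⟩-injˡ (to ∈sg i) | ⟨⟩-injʳ (to ∈sg i)
      ...   | refl | refl = (λ w w∈x → F p w , from ∈∪ (inj₁ (from ∈H₀
                (TC-trans x ∈TC-refl w w∈x , F-value (hv w w∈x))))) , cong (G p x) (sym img≡)
      H-attempt u v uv | inj₁ i =
        (λ w w∈u → F p w , from ∈∪ (inj₁ (from ∈H₀ (sub w w∈u , F-value (hasValue-∈ hu w∈u)))))
        , trans (proj₂ (A u v uv')) (cong (G p u) (⊆-antisym img-set img-set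
            (λ z j → let (w , w∈u , wz) = to ∈img j in
              from ∈img (w , w∈u , from ∈∪ (inj₁ (from ∈H₀ (sub w w∈u , h , A , wz)))))
            (λ z j → let (w , w∈u , wz) = to ∈img j
                         -- Since x has no value and u has one, x is not an element of u; so the
                         -- pair added for x contributes nothing to `img H u`.
                         vz = proj₂ (to ∈H₀ (∈H (λ e → nx (hasValue-∈ hu (subst (_∈ u) e w∈u))) wz))
                         (z' , wz') = proj₁ (A u v uv') w w∈u
                     in from ∈img (w , w∈u , subst (λ z → ⟨ w , z ⟩ ∈ h) (value-unique (h , A , wz') vz) wz'))))
        where
        u∈ = proj₁ (to ∈H₀ i)
        hu : HasValue p u
        hu = v , proj₂ (to ∈H₀ i)
        h = proj₁ (proj₂ hu)
        A = proj₁ (proj₂ (proj₂ hu))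
        uv' = proj₂ (proj₂ (proj₂ hu))
        sub : ∀ w → w ∈ u → w ∈ TC x
        sub w w∈u = TC-trans u u∈ w w∈u

    opaque
      hasValue : ∀ p x → HasValue p x
      hasValue p = ∈-ind {k = 0} φ [] (p ∷ []) λ x ih → stable λ nx → nx (extend p x nx ih)

    opaque
      F″ : Carrier → Carrier → Carrier
      F″ p x = image {k = 0} (Fᵗ (var 1F) (var 0F)) [] (p ∷ []) x

      F″-set : ∀ {p x} → IsSet U (F″ p x)
      F″-set {p} {x} = image-set {k = 0} (Fᵗ (var 1F) (var 0F)) [] (p ∷ []) x

      ∈F″ : ∀ {p x y} → y ∈ F″ p x ⇔ (∃[ u ] u ∈ x × y ≡ F p u)
      ∈F″ {p} {x} = ∈image {k = 0} (Fᵗ (var 1F) (var 0F)) [] (p ∷ []) x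

    F-eq : ∀ p x → F p x ≡ G p x (F″ p x)
    F-eq p x with F-value (hasValue p x)
    ... | h , A , i = trans (proj₂ (A x (F p x) i)) (cong (G p x) (⊆-antisym img-set F″-set
      (λ v j → let (u , u∈x , uv) = to ∈img j in from ∈F″ (u , u∈x , sym (F≡ (h , A , uv))))
      (λ v j → let (u , u∈x , e) = to ∈F″ j
                   (v' , uv') = proj₁ (A x (F p x) i) u u∈x
               in from ∈img (u , u∈x , subst (λ v → ⟨ u , v ⟩ ∈ h) (trans (sym (F≡ (h , A , uv'))) (sym e)) uv'))))

  -- Automorphisms induced by permutations of the urelements

  -- For involutions it is enough to ask for preservation in one direction, because the inverse is π
  -- again.
  record Involution : Set ℓ where
    field
      π    : Carrier → Carrier
      ππ   : ∀ x → π (π x) ≡ x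
      π-∈⁺ : ∀ {x y} → x ∈ y → π x ∈ π y
      π-𝒜⁺ : ∀ {x} → 𝒜 x → 𝒜 (π x)

    π-∈ : ∀ {x y} → x ∈ y ⇔ π x ∈ π y
    π-∈ = mk⇔ π-∈⁺ λ i → subst₂ _∈_ (ππ _) (ππ _) (π-∈⁺ i)

    π-inj : ∀ {x y} → π x ≡ π y → x ≡ y
    π-inj e = trans (sym (ππ _)) (trans (cong π e) (ππ _))

    π-sat : ∀ {n} (φ : Formula n) ρ → Sat U φ ρ ⇔ Sat U φ (map π ρ)
    π-sat (i ≐ j) ρ rewrite lookup-map i π ρ | lookup-map j π ρ = mk⇔ (cong π) π-inj
    π-sat (i ∈̇ j) ρ rewrite lookup-map i π ρ | lookup-map j π ρ = π-∈
    π-sat (𝒜̇ i)   ρ rewrite lookup-map i π ρ = mk⇔ π-𝒜⁺ λ a → subst 𝒜 (ππ _) (π-𝒜⁺ a)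
    π-sat (¬̇ φ)   ρ = ¬-cong-⇔ (π-sat φ ρ)
    π-sat (φ ∧̇ ψ) ρ = _×-⇔_ (π-sat φ ρ) (π-sat ψ ρ)
    π-sat (∃̇ φ)   ρ = mk⇔ (λ (x , h) → π x , to (π-sat φ (x ∷ ρ)) h)
      λ (x , h) → π x , from (π-sat φ (π x ∷ ρ)) (subst (λ x → Sat U φ (x ∷ map π ρ)) (sym (ππ x)) h)

    -- Formulas contain no constants, so the image of a definable class under an automorphism is
    -- defined by the same formula from the moved parameter. Thus π acts on the second sort as well,
    -- and second-order truth is invariant.
    πᶜ : Class U → Class U
    πᶜ ⟪ ψ , z ⟫ = ⟪ ψ , π z ⟫

    π-∈ᶜ : ∀ X {x} → _∈ᶜ_ U x X ⇔ _∈ᶜ_ U (π x) (πᶜ X)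
    π-∈ᶜ ⟪ ψ , z ⟫ = π-sat ψ (_ ∷ z ∷ [])

    ∈πᶜ : ∀ X {x} → _∈ᶜ_ U x (πᶜ X) ⇔ _∈ᶜ_ U (π x) X
    ∈πᶜ X {x} = ⇔-sym (subst (λ v → _∈ᶜ_ U (π x) X ⇔ _∈ᶜ_ U v (πᶜ X)) (ππ x) (π-∈ᶜ X))

    π-sat₂ : ∀ {k n} (φ : Formula₂ k n) Γ ρ → Sat₂ U φ Γ ρ ⇔ Sat₂ U φ (map πᶜ Γ) (map π ρ)
    π-sat₂ (i ≐ j) Γ ρ rewrite lookup-map i π ρ | lookup-map j π ρ = mk⇔ (cong π) π-inj
    π-sat₂ (i ∈̇ j) Γ ρ rewrite lookup-map i π ρ | lookup-map j π ρ = π-∈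
    π-sat₂ (𝒜̇ i)   Γ ρ rewrite lookup-map i π ρ = mk⇔ π-𝒜⁺ λ a → subst 𝒜 (ππ _) (π-𝒜⁺ a)
    π-sat₂ (i ∈̂ j) Γ ρ rewrite lookup-map i π ρ | lookup-map j πᶜ Γ = π-∈ᶜ (lookup Γ j)
    π-sat₂ (¬̇ φ)   Γ ρ = ¬-cong-⇔ (π-sat₂ φ Γ ρ)
    π-sat₂ (φ ∧̇ ψ) Γ ρ = _×-⇔_ (π-sat₂ φ Γ ρ) (π-sat₂ ψ Γ ρ)
    π-sat₂ (∃̇ φ)   Γ ρ = mk⇔ (λ (x , h) → π x , to (π-sat₂ φ Γ (x ∷ ρ)) h)
      λ (x , h) → π x , from (π-sat₂ φ Γ (π x ∷ ρ))
        (subst (λ x → Sat₂ U φ (map πᶜ Γ) (x ∷ map π ρ)) (sym (ππ x)) h)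
    π-sat₂ (∃̂ φ)   Γ ρ = mk⇔ (λ (X , h) → πᶜ X , to (π-sat₂ φ (X ∷ Γ) ρ) h)
      λ { (⟪ ψ , z ⟫ , h) → ⟪ ψ , π z ⟫ , from (π-sat₂ φ (⟪ ψ , π z ⟫ ∷ Γ) ρ)
        (subst (λ z → Sat₂ U φ (⟪ ψ , z ⟫ ∷ map πᶜ Γ) (map π ρ)) (sym (ππ z)) h) }

    π-TC : ∀ {a x} → a ∈ TC x → π a ∈ TC (π x)
    π-TC i = from ∈TC λ t tr πx∈t → subst (_ ∈_) (ππ t) (π-∈⁺ (to ∈TC i (π t)
      (λ y y∈ w w∈y → subst (_∈ π t) (ππ w) (π-∈⁺ (tr (π y) (to-t t y∈) (π w) (π-∈⁺ w∈y))))
      (subst (_∈ π t) (ππ _) (π-∈⁺ πx∈t))))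
      where
      to-t : ∀ t {y} → y ∈ π t → π y ∈ t
      to-t t i = subst (_ ∈_) (ππ t) (π-∈⁺ i)

  Linked : Carrier → Carrier → Carrier → Set ℓ
  Linked f a b = ⟨ a , b ⟩ ∈ f ⊎ ⟨ b , a ⟩ ∈ f

  opaque
    swap : Carrier → Carrier → Carrier
    swap f a = theElement (Linked f a) a

    swapᵗ : ∀ {k n f g} → Tm k n f → Tm k n g → Tm k n (λ Γ ρ → swap (f Γ ρ) (g Γ ρ))
    swapᵗ t u = theElementᵗ (⟨ wk u , var 0F ⟩ᵗ ∈′ wk t ∨′ ⟨ var 0F , wk u ⟩ᵗ ∈′ wk t) u

    swap-unlinked : ∀ {f a} → (∀ b → ¬ Linked f a b) → swap f a ≡ a
    swap-unlinked h = theElement-none h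

    swap-linked : ∀ {f a b} → (∀ c → Linked f a c → c ≡ b) → Linked f a b → swap f a ≡ b
    swap-linked u l = theElement≡ l u

  opaque
    -- Step function of the recursion that extends a permutation of the urelements: i will be the
    -- set of images of the elements of x. The case distinction is phrased as a definite description
    -- so that it is a term.
    swapOr : Carrier → Carrier → Carrier → Carrier
    swapOr f x i = theElement (λ y → (𝒜 x × y ≡ swap f x) ⊎ (¬ 𝒜 x × y ≡ i)) ∅

    swapOrᵗ : ∀ {k n f g h} → Tm k n f → Tm k n g → Tm k n h →
              Tm k n (λ Γ ρ → swapOr (f Γ ρ) (g Γ ρ) (h Γ ρ))
    swapOrᵗ t u v = theElementᵗ ((𝒜′ (wk u) ∧′ var 0F ≐′ swapᵗ (wk t) (wk u)) ∨′ (¬′ 𝒜′ (wk u) ∧′ var 0F ≐′ wk v)) ∅ᵗ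

    swapOr-𝒜 : ∀ {f x i} → 𝒜 x → swapOr f x i ≡ swap f x
    swapOr-𝒜 a = theElement≡ (inj₁ (a , refl)) λ y' → [ proj₂ , (λ (na , _) → ⊥-elim (na a)) ]′

    swapOr-set : ∀ {f x i} → ¬ 𝒜 x → swapOr f x i ≡ i
    swapOr-set na = theElement≡ (inj₂ (na , refl)) λ y' → [ (λ (a , _) → ⊥-elim (na a)) , proj₂ ]′

  open Recursion swapOr swapOrᵗ using () renaming
    ( F to permute; Fᵗ to permuteᵗ; F-eq to permute-eq
    ; F″ to permute″; F″-set to permute″-set; ∈F″ to ∈permute″ )

  -- The pairs in f are the 2-cycles (and possibly fixed points) of a permutation of the urelements.
  Cycles : Carrier → Set ℓ
  Cycles f = (∀ {a b} → ⟨ a , b ⟩ ∈ f → 𝒜 a × 𝒜 b) × (∀ {a b c} → Linked f a b → Linked f a c → b ≡ c)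

  module _ {f : Carrier} (cyc : Cycles f) where
    linked-sym : ∀ {a b} → Linked f a b → Linked f b a
    linked-sym = [ inj₂ , inj₁ ]′

    linked-swap : ∀ {a b} → Linked f a b → swap f a ≡ b
    linked-swap l = swap-linked (λ c l' → proj₂ cyc l' l) l

    linked-𝒜 : ∀ {a b} → Linked f a b → 𝒜 b
    linked-𝒜 = [ (λ i → proj₂ (proj₁ cyc i)) , (λ i → proj₁ (proj₁ cyc i)) ]′

    swap-𝒜 : ∀ {a} → 𝒜 a → 𝒜 (swap f a)
    swap-𝒜 {a} ua with em {∃[ b ] Linked f a b}
    ... | yes (b , l) = subst 𝒜 (sym (linked-swap l)) (linked-𝒜 l)
    ... | no n        = subst 𝒜 (sym (swap-unlinked λ b l → n (b , l))) ua

    swap-swap : ∀ a → swap f (swap f a) ≡ a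
    swap-swap a with em {∃[ b ] Linked f a b}
    ... | yes (b , l) = trans (cong (swap f) (linked-swap l)) (linked-swap (linked-sym l))
    ... | no n        = trans (cong (swap f) e) e
      where e = swap-unlinked λ b l → n (b , l)

    permute-𝒜 : ∀ {a} → 𝒜 a → permute f a ≡ swap f a
    permute-𝒜 ua = trans (permute-eq f _) (swapOr-𝒜 ua)

    permute-set : ∀ {x} → ¬ 𝒜 x → permute f x ≡ permute″ f x
    permute-set nx = trans (permute-eq f _) (swapOr-set nx)

    permute-set-set : ∀ {x} → ¬ 𝒜 x → ¬ 𝒜 (permute f x)
    permute-set-set nx = subst (IsSet U) (sym (permute-set nx)) permute″-set

    ∈permute : ∀ {x w} → ¬ 𝒜 x → w ∈ permute f x ⇔ (∃[ u ] u ∈ x × w ≡ permute f u)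
    ∈permute {x} {w} nx = subst (λ v → w ∈ v ⇔ (∃[ u ] u ∈ x × w ≡ permute f u)) (sym (permute-set nx)) ∈permute″

    permute-permute : ∀ x → permute f (permute f x) ≡ x
    permute-permute = ∈-ind {k = 0} (permuteᵗ (var 1F) (permuteᵗ (var 1F) (var 0F)) ≐′ var 0F) [] (f ∷ []) step
      where
      step : ∀ x → (∀ y → y ∈ x → permute f (permute f y) ≡ y) → permute f (permute f x) ≡ x
      step x ih with em {𝒜 x}
      ... | yes ux = trans (cong (permute f) (permute-𝒜 ux)) (trans (permute-𝒜 (swap-𝒜 ux)) (swap-swap x))
      ... | no nx  = ⊆-antisym (permute-set-set (permute-set-set nx)) nx
        (λ w i → let (u , u∈ , e) = to (∈permute (permute-set-set nx)) i
                     (v , v∈x , e') = to (∈permute nx) u∈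
                 in subst (_∈ x) (sym (trans e (trans (cong (permute f) e') (ih v v∈x)))) v∈x)
        (λ w i → from (∈permute (permute-set-set nx))
          (permute f w , from (∈permute nx) (w , i , refl) , sym (ih w i)))

    permutation : Involution
    permutation = record
      { π = permute f
      ; ππ = permute-permute
      ; π-∈⁺ = λ i → from (∈permute (nonempty⇒set i)) (_ , i , refl)
      ; π-𝒜⁺ = λ a → subst 𝒜 (sym (permute-𝒜 a)) (swap-𝒜 a)
      }

    -- By ∈-induction inside t, where a set goes anywhere depends only on where the urelements below
    -- it go.
    permute-fixes : ∀ {t} → Trans t → (∀ {a} → a ∈ t → 𝒜 a → swap f a ≡ a) → ∀ {x} → x ∈ t → permute f x ≡ x
    permute-fixes {t} tr h {x} = ∈-ind {k = 0}
      (var 0F ∈′ var 1F ⇒′ permuteᵗ (var 2F) (var 0F) ≐′ var 0F) [] (t ∷ f ∷ []) step x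
      where
      step : ∀ x → (∀ y → y ∈ x → y ∈ t → permute f y ≡ y) → x ∈ t → permute f x ≡ x
      step x ih x∈t with em {𝒜 x}
      ... | yes ux = trans (permute-𝒜 ux) (h x∈t ux)
      ... | no nx  = ⊆-antisym (permute-set-set nx) nx
        (λ w i → let (u , u∈x , e) = to (∈permute nx) i in
          subst (_∈ x) (sym (trans e (ih u u∈x (tr x x∈t u u∈x)))) u∈x)
        (λ w i → from (∈permute nx) (w , i , sym (ih w i (tr x x∈t w i))))

  -- A class without a minimal support

  transposition-cycles : ∀ {c d} → 𝒜 c → 𝒜 d → Cycles (sg ⟨ c , d ⟩)
  transposition-cycles {c} {d} uc ud =
    (λ i → let e = to ∈sg i in subst 𝒜 (sym (⟨⟩-injˡ e)) uc , subst 𝒜 (sym (⟨⟩-injʳ e)) ud) ,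
    λ l l' → functional (linked l) (linked l')
    where
    linked : ∀ {a b} → Linked (sg ⟨ c , d ⟩) a b → (a ≡ c × b ≡ d) ⊎ (a ≡ d × b ≡ c)
    linked (inj₁ i) = let e = to ∈sg i in inj₁ (⟨⟩-injˡ e , ⟨⟩-injʳ e)
    linked (inj₂ i) = let e = to ∈sg i in inj₂ (⟨⟩-injʳ e , ⟨⟩-injˡ e)
    functional : ∀ {a b b'} → (a ≡ c × b ≡ d) ⊎ (a ≡ d × b ≡ c) → (a ≡ c × b' ≡ d) ⊎ (a ≡ d × b' ≡ c) → b ≡ b'
    functional (inj₁ (refl , refl)) (inj₁ (_ , refl)) = refl
    functional (inj₁ (refl , refl)) (inj₂ (refl , refl)) = refl
    functional (inj₂ (refl , refl)) (inj₁ (refl , refl)) = refl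
    functional (inj₂ (refl , refl)) (inj₂ (_ , refl)) = refl

  transposition-fixes : ∀ {c d a} → a ≢ c → a ≢ d → swap (sg ⟨ c , d ⟩) a ≡ a
  transposition-fixes a≢c a≢d = swap-unlinked λ b →
    [ (λ i → a≢c (⟨⟩-injˡ (to ∈sg i))) , (λ i → a≢d (⟨⟩-injʳ (to ∈sg i))) ]′

  -- Chains of disjoint pairs of urelements

  Fresh : Carrier → Carrier → Carrier → Set ℓ
  Fresh A x a = 𝒜 a × ¬ a ∈ A × ¬ a ∈ TC x

  -- The relation fed to the DC-scheme; x is the set of pairs chosen so far. As `TC x` contains all
  -- components of these pairs, freshness makes the new pair disjoint from the old ones.
  Extends : Carrier → Carrier → Carrier → Set ℓ
  Extends A x y = ∃[ a ] ∃[ b ] Fresh A x a × Fresh A x b × a ≢ b × y ≡ x ∪ sg ⟨ a , b ⟩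

  opaque
    Fresh′ : ∀ {k n f g h} → Tm k n f → Tm k n g → Tm k n h → Fm k n (λ Γ ρ → Fresh (f Γ ρ) (g Γ ρ) (h Γ ρ))
    Fresh′ A x a = 𝒜′ a ∧′ (¬′ a ∈′ A) ∧′ (¬′ a ∈′ TCᵗ x)

    Extends′ : ∀ {k n f g h} → Tm k n f → Tm k n g → Tm k n h → Fm k n (λ Γ ρ → Extends (f Γ ρ) (g Γ ρ) (h Γ ρ))
    Extends′ A x y = ∃′ (∃′ (Fresh′ (wk (wk A)) (wk (wk x)) (var 1F) ∧′ Fresh′ (wk (wk A)) (wk (wk x)) (var 0F) ∧′
      (¬′ var 1F ≐′ var 0F) ∧′ wk (wk y) ≐′ (wk (wk x) ∪ᵗ sgᵗ ⟨ var 1F , var 0F ⟩ᵗ)))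

  opaque
    at : Carrier → Carrier → Carrier
    at s n = theElement (λ v → ⟨ n , v ⟩ ∈ s) ∅

    atᵗ : ∀ {k n f g} → Tm k n f → Tm k n g → Tm k n (λ Γ ρ → at (f Γ ρ) (g Γ ρ))
    atᵗ t u = theElementᵗ (⟨ wk u , var 0F ⟩ᵗ ∈′ wk t) ∅ᵗ

    at≡ : ∀ {s n v} → ∃! _≡_ (λ v → ⟨ n , v ⟩ ∈ s) → ⟨ n , v ⟩ ∈ s → at s n ≡ v
    at≡ (v , _ , un) i = theElement≡ i λ y' j → trans (sym (un j)) (un i)

  Component : Carrier → Carrier → Set ℓ
  Component c p = ∃[ a ] ∃[ b ] p ≡ ⟨ a , b ⟩ × (c ≡ a ⊎ c ≡ b)

  component-∈TC : ∀ {c p x} → Component c p → p ∈ x → c ∈ TC x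
  component-∈TC {c} {p} {x} (a , b , refl , e) p∈x =
    [ (λ { refl → flat (fst∈⋃⋃ p∈TC) }) , (λ { refl → flat (snd∈⋃⋃ p∈TC) }) ]′ e
    where
    p∈TC : ⟨ a , b ⟩ ∈ TC x
    p∈TC = TC-trans x ∈TC-refl _ p∈x
    flat : ∀ {w} → w ∈ ⋃ (⋃ (TC x)) → w ∈ TC x
    flat i = let (v , v∈ , w∈v) = to ∈⋃ i
                 (u , u∈ , v∈u) = to ∈⋃ v∈
             in TC-trans v (TC-trans u u∈ v v∈u) _ w∈v

  FreshPair : Carrier → Carrier → Set ℓ
  FreshPair A p = ∃[ a ] ∃[ b ] p ≡ ⟨ a , b ⟩ × (𝒜 a × ¬ a ∈ A) × (𝒜 b × ¬ b ∈ A) × a ≢ b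

  Separated : Carrier → Set ℓ
  Separated x = ∀ p → p ∈ x → ∀ q → q ∈ x → ∀ c → Component c p → Component c q → p ≡ q

  opaque
    FreshPair′ : ∀ {k n f g} → Tm k n f → Tm k n g → Fm k n (λ Γ ρ → FreshPair (f Γ ρ) (g Γ ρ))
    FreshPair′ A p = ∃′ (∃′ (wk (wk p) ≐′ ⟨ var 1F , var 0F ⟩ᵗ ∧′ (𝒜′ (var 1F) ∧′ ¬′ var 1F ∈′ wk (wk A)) ∧′
      (𝒜′ (var 0F) ∧′ ¬′ var 0F ∈′ wk (wk A)) ∧′ (¬′ var 1F ≐′ var 0F)))

    Component′ : ∀ {k n f g} → Tm k n f → Tm k n g → Fm k n (λ Γ ρ → Component (f Γ ρ) (g Γ ρ))
    Component′ c p = ∃′ (∃′ (wk (wk p) ≐′ ⟨ var 1F , var 0F ⟩ᵗ ∧′ (wk (wk c) ≐′ var 1F ∨′ wk (wk c) ≐′ var 0F)))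

    Separated′ : ∀ {k n f} → Tm k n f → Fm k n (λ Γ ρ → Separated (f Γ ρ))
    Separated′ x = ∀′ (var 0F ∈′ wk x ⇒′ ∀′ (var 0F ∈′ wk (wk x) ⇒′ ∀′
      (Component′ (var 0F) (var 2F) ⇒′ Component′ (var 0F) (var 1F) ⇒′ var 2F ≐′ var 1F)))

  fresh-component : ∀ {A x y} (e : Extends A x y) {c} → Component c ⟨ proj₁ e , proj₁ (proj₂ e) ⟩ → Fresh A x c
  fresh-component (a , b , fa , fb , _) (a' , b' , e , inj₁ refl) = subst (Fresh _ _) (⟨⟩-injˡ e) fa
  fresh-component (a , b , fa , fb , _) (a' , b' , e , inj₂ refl) = subst (Fresh _ _) (⟨⟩-injʳ e) fb

  extends-⊆ : ∀ {A x y} → Extends A x y → x ⊆ y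
  extends-⊆ (a , b , _ , _ , _ , e) w i = subst (w ∈_) (sym e) (from ∈∪ (inj₁ i))

  extends-new : ∀ {A x y} (e : Extends A x y) → ⟨ proj₁ e , proj₁ (proj₂ e) ⟩ ∈ y
  extends-new (a , b , _ , _ , _ , e) = subst (_ ∈_) (sym e) (from ∈∪ (inj₂ (from ∈sg refl)))

  extends-new∉ : ∀ {A x y} (e : Extends A x y) → ¬ ⟨ proj₁ e , proj₁ (proj₂ e) ⟩ ∈ x
  extends-new∉ (a , b , (_ , _ , a∉) , _) i = a∉ (component-∈TC (a , b , refl , inj₁ refl) i)

  module Chain {A s : Carrier} (start : at s ∅ ≡ ∅) (step : ∀ n → n ∈ ω → Extends A (at s n) (at s (S n))) where

    stage : Carrier → Carrier
    stage = at s

    mono : ∀ n → n ∈ ω → ∀ m → m ∈ n → stage m ⊆ stage n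
    mono = ω-ind {k = 0} (∀′ (var 0F ∈′ var 1F ⇒′ (atᵗ (var 2F) (var 0F) ⊆′ atᵗ (var 2F) (var 1F)))) [] (s ∷ [])
      (λ m i → ⊥-elim (∉∅ i))
      (λ n n∈ω ih m i w w∈ → extends-⊆ (step n n∈ω) w ([ (λ m∈n → ih m m∈n w w∈) , (λ { refl → w∈ }) ]′ (to ∈S i)))

    directed : ∀ {m n} → m ∈ ω → n ∈ ω → ∃[ k ] k ∈ ω × stage m ⊆ stage k × stage n ⊆ stage k
    directed {m} {n} m∈ω n∈ω with ∈-trichotomy m∈ω n∈ω
    ... | inj₁ i           = n , n∈ω , mono n n∈ω m i , λ _ → id
    ... | inj₂ (inj₁ refl) = n , n∈ω , (λ _ → id) , λ _ → id
    ... | inj₂ (inj₂ i)    = m , m∈ω , (λ _ → id) , mono m m∈ω n i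

    freshPairs : ∀ n → n ∈ ω → ∀ p → p ∈ stage n → FreshPair A p
    freshPairs = ω-ind {k = 0} (∀′ (var 0F ∈′ atᵗ (var 2F) (var 1F) ⇒′ FreshPair′ (var 3F) (var 0F))) [] (s ∷ A ∷ [])
      (λ p i → ⊥-elim (∉∅ (subst (p ∈_) start i)))
      (λ n n∈ω ih p i → new n ih p (step n n∈ω) i)
      where
      new : ∀ n → (∀ p → p ∈ stage n → FreshPair A p) →
            ∀ p → Extends A (stage n) (stage (S n)) → p ∈ stage (S n) → FreshPair A p
      new n ih p (a , b , (ua , a∉ , _) , (ub , b∉ , _) , a≢b , e) i with to ∈∪ (subst (p ∈_) e i)
      ... | inj₁ j = ih p j
      ... | inj₂ j = a , b , to ∈sg j , (ua , a∉) , (ub , b∉) , a≢b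

    separatedStages : ∀ n → n ∈ ω → Separated (stage n)
    separatedStages = ω-ind {k = 0} (Separated′ (atᵗ (var 1F) (var 0F))) [] (s ∷ [])
      (λ p i → ⊥-elim (∉∅ (subst (p ∈_) start i)))
      (λ n n∈ω ih p i q j c cp cq → new n ih (step n n∈ω) p i q j c cp cq)
      where
      new : ∀ n → Separated (stage n) → Extends A (stage n) (stage (S n)) → Separated (stage (S n))
      new n ih ex@(a , b , _ , _ , _ , e) p i q j c cp cq
        with to ∈∪ (subst (p ∈_) e i) | to ∈∪ (subst (q ∈_) e j)
      ... | inj₁ i' | inj₁ j' = ih p i' q j' c cp cq
      ... | inj₂ i' | inj₂ j' = trans (to ∈sg i') (sym (to ∈sg j'))
      ... | inj₁ i' | inj₂ j' = ⊥-elim (proj₂ (proj₂ (fresh-component ex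
            (subst (Component c) (to ∈sg j') cq))) (component-∈TC cp i'))
      ... | inj₂ i' | inj₁ j' = ⊥-elim (proj₂ (proj₂ (fresh-component ex
            (subst (Component c) (to ∈sg i') cp))) (component-∈TC cq j'))

    D : Carrier
    D = ⋃range s

    module _ (value : ∀ n → n ∈ ω → ∃! _≡_ (λ v → ⟨ n , v ⟩ ∈ s)) where

      ∈D : ∀ {p} → p ∈ D ⇔ (∃[ n ] n ∈ ω × p ∈ stage n)
      ∈D {p} = mk⇔
        (λ i → let (n , v , n∈ω , nv , p∈v) = to ∈⋃range i in n , n∈ω , subst (p ∈_) (sym (at≡ (value n n∈ω) nv)) p∈v)
        (λ (n , n∈ω , i) → let (v , nv , un) = value n n∈ω in
          from ∈⋃range (n , v , n∈ω , nv , subst (p ∈_) (at≡ (value n n∈ω) nv) i))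

      D-fresh : ∀ {a b} → ⟨ a , b ⟩ ∈ D → (𝒜 a × ¬ a ∈ A) × (𝒜 b × ¬ b ∈ A) × a ≢ b
      D-fresh i with to ∈D i
      ... | n , n∈ω , j with freshPairs n n∈ω _ j
      ...   | a' , b' , e , h with ⟨⟩-injˡ e | ⟨⟩-injʳ e
      ...     | refl | refl = h

      D-separated : Separated D
      D-separated p i q j =
        let (m , m∈ω , i') = to ∈D i
            (n , n∈ω , j') = to ∈D j
            (k , k∈ω , m⊆k , n⊆k) = directed m∈ω n∈ω
        in separatedStages k k∈ω p (m⊆k p i') q (n⊆k q j')

      D-disjoint : ∀ {a b a' b' c} → ⟨ a , b ⟩ ∈ D → ⟨ a' , b' ⟩ ∈ D →
                     c ≡ a ⊎ c ≡ b → c ≡ a' ⊎ c ≡ b' → a ≡ a' × b ≡ b'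
      D-disjoint i j h h' =
        let e = D-separated _ i _ j _ (_ , _ , refl , h) (_ , _ , refl , h') in ⟨⟩-injˡ e , ⟨⟩-injʳ e

      D-cycles : Cycles D
      D-cycles = (λ i → let ((ua , _) , (ub , _) , _) = D-fresh i in ua , ub) , functional
        where
        functional : ∀ {a b c} → Linked D a b → Linked D a c → b ≡ c
        functional (inj₁ i) (inj₁ j) = proj₂ (D-disjoint i j (inj₁ refl) (inj₁ refl))
        functional (inj₂ i) (inj₂ j) = proj₁ (D-disjoint i j (inj₂ refl) (inj₂ refl))
        -- Here a would come first in one pair and second in the other; disjointness identifies the
        -- two pairs, so all three urelements coincide.
        functional (inj₁ i) (inj₂ j) with D-disjoint i j (inj₁ refl) (inj₂ refl)
        ... | refl , refl = refl
        functional (inj₂ i) (inj₁ j) with D-disjoint i j (inj₂ refl) (inj₁ refl)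
        ... | refl , refl = refl

      swap-D-fixes : ∀ {a} → a ∈ A → swap D a ≡ a
      swap-D-fixes a∈A = swap-unlinked λ b →
        [ (λ i → proj₂ (proj₁ (D-fresh i)) a∈A) , (λ i → proj₂ (proj₁ (proj₂ (D-fresh i))) a∈A) ]′

      -- By disjointness at most one pair involves c, and n is a stage that already contains it. If
      -- there is none, stage ∅ will do.
      boundOf : ∀ c → ∃[ n ] n ∈ ω × (∀ p → p ∈ D → Component c p → p ∈ stage n)
      boundOf c with em {∃[ p ] p ∈ D × Component c p}
      ... | no h = ∅ , ∅∈ω , λ p i cp → ⊥-elim (h (p , i , cp))
      ... | yes (p , i , cp) = let (n , n∈ω , j) = to ∈D i in
        n , n∈ω , λ q q∈D cq → subst (_∈ stage n) (D-separated p i q q∈D c cp cq) j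

  -- "For almost all pairs" is expressed as "for all pairs outside some stage", which avoids an
  -- internal notion of finiteness.
  AlmostSplits : Carrier → Carrier → Set ℓ
  AlmostSplits s t = ∃[ n ] n ∈ ω × (∀ a b → ⟨ a , b ⟩ ∈ ⋃range s → ¬ ⟨ a , b ⟩ ∈ at s n → a ∈ t × ¬ b ∈ t)

  opaque
    AlmostSplits′ : Fm 0 2 (λ _ ρ → AlmostSplits (lookup ρ 1F) (lookup ρ 0F))
    AlmostSplits′ = ∃′ (var 0F ∈′ ωᵗ ∧′ ∀′ (∀′ (⟨ var 1F , var 0F ⟩ᵗ ∈′ ⋃rangeᵗ (var 4F) ⇒′
      (¬′ ⟨ var 1F , var 0F ⟩ᵗ ∈′ atᵗ (var 4F) (var 2F)) ⇒′ (var 1F ∈′ var 3F ∧′ ¬′ var 0F ∈′ var 3F))))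

    splitters : Carrier → Class U
    splitters s = ⟪ formula AlmostSplits′ [] , s ⟫

    ∈splitters : ∀ {s t} → _∈ᶜ_ U t (splitters s) ⇔ AlmostSplits s t
    ∈splitters {s} {t} = formula-sat AlmostSplits′ [] (t ∷ s ∷ [])

  module _ (noSet : ¬ UrelementsFormSet U) where
    -- If t contained every urelement, Separation would cut the set of all urelements out of t.
    urelement∉ : ∀ t → ∃[ a ] 𝒜 a × ¬ a ∈ t
    urelement∉ t = stable λ h → noSet (sep {k = 0} (𝒜′ (var 0F)) [] [] t , sep-set ,
      λ x → mk⇔ (λ i → proj₂ (to ∈sep i)) λ ux → from ∈sep (stable (λ x∉t → h (x , ux , x∉t)) , ux))

    extension : ∀ A x → ∃[ y ] Extends A x y
    extension A x =
      let (a , ua , a∉) = urelement∉ (A ∪ TC x)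
          (b , ub , b∉) = urelement∉ (A ∪ TC x ∪ sg a)
      in _ , a , b , (ua , (λ i → a∉ (from ∈∪ (inj₁ i))) , (λ i → a∉ (from ∈∪ (inj₂ i))))
         , (ub , (λ i → b∉ (from ∈∪ (inj₁ (from ∈∪ (inj₁ i))))) , (λ i → b∉ (from ∈∪ (inj₁ (from ∈∪ (inj₂ i))))))
         , (λ e → b∉ (from ∈∪ (inj₂ (from ∈sg (sym e))))) , refl

    chain : ∀ A → ∃[ s ] (∀ n → n ∈ ω → ∃! _≡_ λ v → ⟨ n , v ⟩ ∈ s) ×
            at s ∅ ≡ ∅ × (∀ n → n ∈ ω → Extends A (at s n) (at s (S n)))
    chain A with dependentChoices (Extends′ (var 2F) (var 0F) (var 1F)) A (extension A) ∅
    ... | s , value , start , step = s , value , at≡ (value ∅ ∅∈ω) start , λ n n∈ω →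
      let (x , y , nx , Sny , e) = step n n∈ω in
      subst₂ (Extends A) (sym (at≡ (value n n∈ω) nx)) (sym (at≡ (value (S n) (S∈ω n∈ω)) Sny)) e

  module _ {s A : Carrier} (value : ∀ n → n ∈ ω → ∃! _≡_ λ v → ⟨ n , v ⟩ ∈ s)
           (start : at s ∅ ≡ ∅) (step : ∀ n → n ∈ ω → Extends A (at s n) (at s (S n))) where
    open Chain start step

    -- All but finitely many pairs of the chain are disjoint from {c , d}.
    almostSplits-transposition : ∀ {c d} (uc : 𝒜 c) (ud : 𝒜 d) → ∀ {t} → AlmostSplits s t →
                                 AlmostSplits s (permute (sg ⟨ c , d ⟩) t)
    almostSplits-transposition {c} {d} uc ud {t} (n , n∈ω , h) =
      let (nc , nc∈ω , hc) = boundOf value c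
          (nd , nd∈ω , hd) = boundOf value d
          (k , k∈ω , n⊆k , nc⊆k) = directed n∈ω nc∈ω
          (l , l∈ω , k⊆l , nd⊆l) = directed k∈ω nd∈ω
      in l , l∈ω , λ a b i i∉ →
        let (a∈t , b∉t) = h a b i (λ j → i∉ (k⊆l _ (n⊆k _ j)))
            ((ua , _) , (ub , _) , _) = D-fresh value i
            fix : ∀ {e} → 𝒜 e → Component e ⟨ a , b ⟩ → π e ≡ e
            fix ue ce = trans (permute-𝒜 cyc ue) (transposition-fixes
              (λ { refl → i∉ (k⊆l _ (nc⊆k _ (hc _ i ce))) })
              (λ { refl → i∉ (nd⊆l _ (hd _ i ce)) }))
            πa = fix ua (a , b , refl , inj₁ refl)
            πb = fix ub (a , b , refl , inj₂ refl)
        in subst (_∈ π t) πa (π-∈⁺ a∈t)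
         , λ b∈ → b∉t (subst₂ _∈_ πb (ππ t) (π-∈⁺ b∈))
      where
      cyc = transposition-cycles uc ud
      open Involution (permutation cyc)

    splitters-transposition : ∀ {c d} (uc : 𝒜 c) (ud : 𝒜 d) →
      _≈ᶜ_ U (splitters s) (Involution.πᶜ (permutation (transposition-cycles uc ud)) (splitters s))
    splitters-transposition uc ud x = ⇔-trans ∈splitters (⇔-trans
      (mk⇔ (almostSplits-transposition uc ud)
           (λ h → subst (AlmostSplits s) (ππ x) (almostSplits-transposition uc ud h)))
      (⇔-trans (⇔-sym ∈splitters) (⇔-sym (∈πᶜ (splitters s)))))
      where open Involution (permutation (transposition-cycles uc ud))

    -- The set `left` of all first components belongs to the class. Its image under the permutation
    -- collects the second components instead and splits no pair of D the right way.
    splitters-moved : ¬ _≈ᶜ_ U (splitters s) (Involution.πᶜ (permutation (D-cycles value)) (splitters s))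
    splitters-moved h =
      let (n , n∈ω , k) = to ∈splitters (to (∈πᶜ (splitters s)) (to (h left) (from ∈splitters left-splits)))
          -- Whatever exceptional stage n is offered, the pair added right after it is not an
          -- exception.
          e@(a , b , _) = step n n∈ω
          i = from (∈D value) (S n , S∈ω n∈ω , extends-new e)
          (a∈πleft , _) = k a b i (extends-new∉ e)
          πa∈left = subst (π a ∈_) (ππ left) (π-∈⁺ a∈πleft)
          πa≡b = trans (permute-𝒜 cyc (proj₁ (proj₁ (D-fresh value i)))) (linked-swap cyc (inj₁ i))
          (c , j) = ∈left→ (subst (_∈ left) πa≡b πa∈left)
      in proj₂ (proj₂ (D-fresh value i)) (proj₁ (D-disjoint value i j (inj₂ refl) (inj₁ refl)))
      where
      cyc = D-cycles value
      open Involution (permutation cyc)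
      φ : Fm 0 2 (λ _ ρ → ∃[ b ] ⟨ lookup ρ 0F , b ⟩ ∈ lookup ρ 1F)
      φ = ∃′ (⟨ var 1F , var 0F ⟩ᵗ ∈′ var 2F)
      left = sep φ [] (D ∷ []) (⋃ (⋃ D))
      ∈left→ : ∀ {a} → a ∈ left → ∃[ b ] ⟨ a , b ⟩ ∈ D
      ∈left→ i = proj₂ (to (∈sep {φ = φ}) i)
      left-splits : AlmostSplits s left
      left-splits = ∅ , ∅∈ω , λ a b i _ → from (∈sep {φ = φ}) (fst∈⋃⋃ i , b , i) , λ b∈ →
        let (c , j) = ∈left→ b∈ in
        proj₂ (proj₂ (D-fresh value i)) (proj₁ (D-disjoint value i j (inj₂ refl) (inj₁ refl)))

  -- The implication (3) ⇒ (1)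

  parametric⇒set : (∃[ ε ] ParametricallyDefinable U ε × BasicLawV U ε) → UrelementsFormSet U
  parametric⇒set (ε , (φ , P@(⟪ ψ , z ⟫) , def) , blv) = stable contradiction
    where
    A = TC z
    -- An automorphism that fixes z sends the presentation of the parameter class P to itself, so
    -- the second-order graph of ε is invariant under it.
    ε-π : (I : Involution) → Involution.π I z ≡ z → ∀ X → ε (Involution.πᶜ I X) ≡ Involution.π I (ε X)
    ε-π I πz X = from (def (πᶜ X) (π (ε X)))
      (subst (λ z → Sat₂ U φ (πᶜ X ∷ ⟪ ψ , z ⟫ ∷ []) (π (ε X) ∷ [])) πz
        (to (π-sat₂ φ (X ∷ P ∷ []) (ε X ∷ [])) (to (def X (ε X)) refl)))
      where open Involution I
    contradiction : ¬ ¬ UrelementsFormSet U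
    contradiction noSet with chain noSet A
    ... | s , value , start , step = splitters-moved value start step
          (to (blv X (πᶜ X)) (trans
            (sym (permute-fixes cyc TC-trans (λ i ua → swap-D-fixes value (supported i ua)) ∈TC-refl))
            (sym (ε-π (permutation cyc) (permute-fixes cyc TC-trans (λ i _ → swap-D-fixes value i) ∈TC-refl) X))))
      where
      open Chain start step
      cyc = D-cycles value
      open Involution (permutation cyc)
      X = splitters s
      y = ε X
      fixed : ∀ {c d} (uc : 𝒜 c) (ud : 𝒜 d) → ¬ c ∈ A → ¬ d ∈ A → permute (sg ⟨ c , d ⟩) y ≡ y
      fixed uc ud c∉ d∉ = trans
        (sym (ε-π (permutation τ) (permute-fixes τ TC-trans
          (λ i _ → transposition-fixes (λ { refl → c∉ i }) (λ { refl → d∉ i })) ∈TC-refl) X))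
        (sym (from (blv X _) (splitters-transposition value start step uc ud)))
        where τ = transposition-cycles uc ud
      supported : ∀ {c} → c ∈ TC y → 𝒜 c → c ∈ A
      supported {c} c∈ uc = stable λ c∉ →
        -- The transposition of c and d fixes y, hence maps `TC y` to itself and would bring d,
        -- chosen outside, into it.
        let (d , ud , d∉) = urelement∉ noSet (A ∪ TC y)
            τ = transposition-cycles uc ud
            d∉A = λ i → d∉ (from ∈∪ (inj₁ i))
        in d∉ (from ∈∪ (inj₂ (subst₂ (λ d y → d ∈ TC y)
             (trans (permute-𝒜 τ uc) (linked-swap τ (inj₁ (from ∈sg refl))))
             (fixed uc ud c∉ d∉A)
             (Involution.π-TC (permutation τ) c∈))))

  -- Truth levels and abstraction

  num : ℕ → Carrier
  num zero    = ∅
  num (suc k) = S (num k)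

  numᵗ : ∀ {k n} j → Tm k n (λ _ _ → num j)
  numᵗ zero    = ∅ᵗ
  numᵗ (suc j) = Sᵗ (numᵗ j)

  num-inj : ∀ {i j} → num i ≡ num j → i ≡ j
  num-inj {zero}  {zero}  e = refl
  num-inj {zero}  {suc j} e = ⊥-elim (∅≢S e)
  num-inj {suc i} {zero}  e = ⊥-elim (∅≢S (sym e))
  num-inj {suc i} {suc j} e = cong suc (num-inj (S-inj e))

  num∈ω : ∀ k → num k ∈ ω
  num∈ω zero    = ∅∈ω
  num∈ω (suc k) = S∈ω (num∈ω k)

  opaque
    -- T consists of triples: at level n the formula coded by c is true under the assignment ρ.
    -- Below the depth of the formula the entries carry no meaning (every negation holds at level 1
    -- of a hierarchy), but they are still determined, which is all that uniqueness uses.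
    Holds : Class U → Carrier → Carrier → Carrier → Set ℓ
    Holds T n c ρ = _∈ᶜ_ U ⟨ n , ⟨ c , ρ ⟩ ⟩ T

  opaque
    -- Tarski's clauses: ρ is a finite partial function from variable names to objects,
    -- and ⟨ k , ⟨ i , j ⟩ ⟩ codes a formula with principal symbol k.
    Clause : Class U → Carrier → Carrier → Carrier → Carrier → Carrier → Set ℓ
    Clause T m k i j ρ =
        (k ≡ num 0 → ∃[ x ] ⟨ i , x ⟩ ∈ ρ × ⟨ j , x ⟩ ∈ ρ)
      × (k ≡ num 1 → ∃[ x ] ∃[ y ] ⟨ i , x ⟩ ∈ ρ × ⟨ j , y ⟩ ∈ ρ × x ∈ y)
      × (k ≡ num 2 → ∃[ x ] ⟨ i , x ⟩ ∈ ρ × 𝒜 x)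
      × (k ≡ num 3 → ¬ Holds T m i ρ)
      × (k ≡ num 4 → Holds T m i ρ × Holds T m j ρ)
      × (k ≡ num 5 → ∃[ x ] Holds T m j (ρ ∪ sg ⟨ i , x ⟩))

  Jump : Class U → Carrier → Carrier → Carrier → Set ℓ
  Jump T n c ρ = ∃[ m ] n ≡ S m × (∃[ k ] ∃[ i ] ∃[ j ] c ≡ ⟨ k , ⟨ i , j ⟩ ⟩ × Clause T m k i j ρ)

  -- Level N itself is included, hence `S N`. Above N the class T is unconstrained.
  Hierarchy : Class U → Carrier → Set ℓ
  Hierarchy T N = ∀ n → n ∈ S N → ∀ c ρ → Holds T n c ρ ⇔ Jump T n c ρ

  opaque
    unfolding Holds Clause

    Holds′ : ∀ {k n f g h} (T : Fin k) → Tm k n f → Tm k n g → Tm k n h →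
             Fm k n (λ Γ ρ → Holds (lookup Γ T) (f Γ ρ) (g Γ ρ) (h Γ ρ))
    Holds′ T n c ρ = ⟨ n , ⟨ c , ρ ⟩ᵗ ⟩ᵗ ∈ᶜ′ T

    Clause′ : ∀ {k n f₁ f₂ f₃ f₄ f₅} (T : Fin k) → Tm k n f₁ → Tm k n f₂ → Tm k n f₃ → Tm k n f₄ → Tm k n f₅ →
              Fm k n (λ Γ ρ → Clause (lookup Γ T) (f₁ Γ ρ) (f₂ Γ ρ) (f₃ Γ ρ) (f₄ Γ ρ) (f₅ Γ ρ))
    Clause′ T m k i j ρ =
         (k ≐′ numᵗ 0 ⇒′ ∃′ (⟨ wk i , var 0F ⟩ᵗ ∈′ wk ρ ∧′ ⟨ wk j , var 0F ⟩ᵗ ∈′ wk ρ))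
      ∧′ (k ≐′ numᵗ 1 ⇒′ ∃′ (∃′
           (⟨ wk (wk i) , var 1F ⟩ᵗ ∈′ wk (wk ρ) ∧′ ⟨ wk (wk j) , var 0F ⟩ᵗ ∈′ wk (wk ρ) ∧′ var 1F ∈′ var 0F)))
      ∧′ (k ≐′ numᵗ 2 ⇒′ ∃′ (⟨ wk i , var 0F ⟩ᵗ ∈′ wk ρ ∧′ 𝒜′ (var 0F)))
      ∧′ (k ≐′ numᵗ 3 ⇒′ ¬′ Holds′ T m i ρ)
      ∧′ (k ≐′ numᵗ 4 ⇒′ Holds′ T m i ρ ∧′ Holds′ T m j ρ)
      ∧′ (k ≐′ numᵗ 5 ⇒′ ∃′ (Holds′ T (wk m) (wk j) (wk ρ ∪ᵗ sgᵗ ⟨ wk i , var 0F ⟩ᵗ)))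

    Jump′ : ∀ {k n f g h} (T : Fin k) → Tm k n f → Tm k n g → Tm k n h →
            Fm k n (λ Γ ρ → Jump (lookup Γ T) (f Γ ρ) (g Γ ρ) (h Γ ρ))
    Jump′ T n c ρ = ∃′ (wk n ≐′ Sᵗ (var 0F) ∧′
      ∃′ (∃′ (∃′ (wk (wk (wk (wk c))) ≐′ ⟨ var 2F , ⟨ var 1F , var 0F ⟩ᵗ ⟩ᵗ ∧′
        Clause′ T (var 3F) (var 2F) (var 1F) (var 0F) (wk (wk (wk (wk ρ))))))))

    Hierarchy′ : ∀ {k n f} (T : Fin k) → Tm k n f → Fm k n (λ Γ ρ → Hierarchy (lookup Γ T) (f Γ ρ))
    Hierarchy′ T N = ∀′ (var 0F ∈′ Sᵗ (wk N) ⇒′ ∀′ (∀′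
      (Holds′ T (var 2F) (var 1F) (var 0F) ⇔′ Jump′ T (var 2F) (var 1F) (var 0F))))

  opaque
    unfolding Clause

    -- A clause looks at T only at level m. The negation clause is antitone, so agreement is
    -- required in both directions.
    clause-mono : ∀ {T T' m k i j ρ} → (∀ c ρ → Holds T m c ρ ⇔ Holds T' m c ρ) →
                  Clause T m k i j ρ → Clause T' m k i j ρ
    clause-mono h (a , b , c , d , e , f) = a , b , c
      , (λ p q → d p (from (h _ _) q))
      , (λ p → to (h _ _) (proj₁ (e p)) , to (h _ _) (proj₂ (e p)))
      , (λ p → proj₁ (f p) , to (h _ _) (proj₂ (f p)))

  jump-mono : ∀ {T T' n c ρ} → (∀ m → n ≡ S m → ∀ c ρ → Holds T m c ρ ⇔ Holds T' m c ρ) →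
              Jump T n c ρ → Jump T' n c ρ
  jump-mono h (m , e , k , i , j , e' , cl) = m , e , k , i , j , e' , clause-mono (h m e) cl

  jump-cong : ∀ {T T' n c ρ} → (∀ m → n ≡ S m → ∀ c ρ → Holds T m c ρ ⇔ Holds T' m c ρ) →
              Jump T n c ρ ⇔ Jump T' n c ρ
  jump-cong h = mk⇔ (jump-mono h) (jump-mono λ m e c ρ → ⇔-sym (h m e c ρ))

  S-transitive : ∀ {n} → n ∈ ω → Trans (S n)
  S-transitive n∈ω = ω-transitive (S∈ω n∈ω)

  -- ∈-induction on n: level n is computed from the level of its predecessor, and level ∅ is empty
  -- because ∅ is no successor.
  hierarchy-unique : ∀ {T T' N N'} → N ∈ ω → N' ∈ ω → Hierarchy T N → Hierarchy T' N' →
    ∀ n → n ∈ S N → n ∈ S N' → ∀ c ρ → Holds T n c ρ ⇔ Holds T' n c ρ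
  hierarchy-unique {T} {T'} {N} {N'} N∈ω N'∈ω H H' = ∈-ind
    (var 0F ∈′ Sᵗ (var 1F) ⇒′ var 0F ∈′ Sᵗ (var 2F) ⇒′ ∀′ (∀′
      (Holds′ 0F (var 2F) (var 1F) (var 0F) ⇔′ Holds′ 1F (var 2F) (var 1F) (var 0F))))
    (T ∷ T' ∷ []) (N ∷ N' ∷ []) λ n ih i i' c ρ →
      ⇔-trans (H n i c ρ) (⇔-trans
        (jump-cong λ m e → let m∈n = subst (m ∈_) (sym e) (from ∈S (inj₂ refl)) in
          ih m m∈n (S-transitive N∈ω n i m m∈n) (S-transitive N'∈ω n i' m m∈n))
        (⇔-sym (H' n i' c ρ)))

  hierarchy-restrict : ∀ {T N n} → N ∈ ω → n ∈ S N → Hierarchy T N → Hierarchy T n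
  hierarchy-restrict N∈ω n∈ H m m∈ = H m ([ S-transitive N∈ω _ n∈ m , (λ { refl → n∈ }) ]′ (to ∈S m∈))

  -- Finite towers, codes of formulas and correctness of truth

  opaque
    unfolding Holds

    Next′ : Fm 1 1 (λ Γ ρ → ∃[ n ] ∃[ c ] ∃[ σ ] head ρ ≡ ⟨ n , ⟨ c , σ ⟩ ⟩ × Jump (head Γ) n c σ)
    Next′ = by (∃′ (∃′ (∃′ (var 3F ≐′ ⟨ var 2F , ⟨ var 1F , var 0F ⟩ᵗ ⟩ᵗ ∧′ Jump′ 0F (var 2F) (var 1F) (var 0F)))))
      λ { (T ∷ []) (t ∷ []) → ⇔-refl }

    -- `Jump` is applied to all levels at once: the levels on which T is a hierarchy are reproduced,
    -- and one new level appears. The parameter of T is reused, so one parameter remains enough.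
    next : Class U → Class U
    next T = ⟪ formula Next′ (T ∷ []) , Class.z T ⟫

    holds-next : ∀ {T n c ρ} → Holds (next T) n c ρ ⇔ Jump T n c ρ
    holds-next {T} {n} {c} {ρ} = ⇔-trans (formula-sat Next′ (T ∷ []) (⟨ n , ⟨ c , ρ ⟩ ⟩ ∷ [])) (mk⇔
      (λ (n' , c' , ρ' , e , h) → unpair (⟨⟩-injˡ e) (⟨⟩-injˡ (⟨⟩-injʳ e)) (⟨⟩-injʳ (⟨⟩-injʳ e)) h)
      (λ h → n , c , ρ , refl , h))
      where
      unpair : ∀ {n' c' ρ'} → n ≡ n' → c ≡ c' → ρ ≡ ρ' → Jump T n' c' ρ' → Jump T n c ρ
      unpair refl refl refl h = h

  -- The recursion runs over the ℕ of the metatheory, since every step lengthens the defining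
  -- formula. The parameter is ∅ throughout.
  tower : ℕ → Class U
  tower zero    = ⟪ ¬̇ (0F ≐ 0F) , ∅ ⟫
  tower (suc k) = next (tower k)

  opaque
    unfolding Holds

    tower-hierarchy : ∀ k → Hierarchy (tower k) (num k)
    tower-hierarchy zero n n∈ c ρ = mk⇔ (λ h → ⊥-elim (h refl)) λ (m , e , _) →
      ⊥-elim ([ ∉∅ , (λ { refl → ∅≢S e }) ]′ (to ∈S n∈))
    tower-hierarchy (suc k) n n∈ c ρ = ⇔-trans holds-next (jump-cong λ m e c ρ →
      ⇔-trans (tower-hierarchy k m (pred m e) c ρ) (⇔-sym holds-next))
      where
      pred : ∀ m → n ≡ S m → m ∈ S (num k)
      pred m refl with to ∈S n∈
      ... | inj₁ i = ω-transitive (num∈ω (suc k)) (S m) i m (from ∈S (inj₂ refl))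
      ... | inj₂ e = from ∈S (inj₂ (S-inj e))

  -- De Bruijn levels: unlike an index, the name of a variable does not change under a binder.
  -- Entering a quantifier in a context of length n only adds `⟨ num n , x ⟩` to the assignment,
  -- exactly as Tarski's last clause does.
  name : ∀ {n} → Fin n → ℕ
  name {suc n} zero    = n
  name {suc n} (suc i) = name i

  name-< : ∀ {n} (i : Fin n) → name i < n
  name-< {suc n} zero    = n<1+n n
  name-< {suc n} (suc i) = m<n⇒m<1+n (name-< i)

  code : ∀ {n} → Formula n → Carrier
  code (i ≐ j) = ⟨ num 0 , ⟨ num (name i) , num (name j) ⟩ ⟩
  code (i ∈̇ j) = ⟨ num 1 , ⟨ num (name i) , num (name j) ⟩ ⟩
  code (𝒜̇ i)   = ⟨ num 2 , ⟨ num (name i) , ∅ ⟩ ⟩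
  code (¬̇ φ)   = ⟨ num 3 , ⟨ code φ , ∅ ⟩ ⟩
  code (φ ∧̇ ψ) = ⟨ num 4 , ⟨ code φ , code ψ ⟩ ⟩
  code {n} (∃̇ φ) = ⟨ num 5 , ⟨ num n , code φ ⟩ ⟩

  depth : ∀ {n} → Formula n → ℕ
  depth (i ≐ j) = 1
  depth (i ∈̇ j) = 1
  depth (𝒜̇ i)   = 1
  depth (¬̇ φ)   = suc (depth φ)
  depth (φ ∧̇ ψ) = suc (depth φ ⊔ depth ψ)
  depth (∃̇ φ)   = suc (depth φ)

  env : ∀ {n} → Vec Carrier n → Carrier
  env []                = ∅
  env {suc n} (x ∷ ρ) = env ρ ∪ sg ⟨ num n , x ⟩

  ∈env-< : ∀ {n} (ρ : Vec Carrier n) {k y} → ⟨ num k , y ⟩ ∈ env ρ → k < n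
  ∈env-< []      i = ⊥-elim (∉∅ i)
  ∈env-< {suc n} (x ∷ ρ) i with to ∈∪ i
  ... | inj₁ j = m<n⇒m<1+n (∈env-< ρ j)
  ... | inj₂ j = subst (_< suc n) (sym (num-inj (⟨⟩-injˡ (to ∈sg j)))) (n<1+n n)

  ∈env : ∀ {n} (ρ : Vec Carrier n) i {y} → ⟨ num (name i) , y ⟩ ∈ env ρ ⇔ (y ≡ lookup ρ i)
  ∈env {suc n} (x ∷ ρ) zero = mk⇔
    (λ i → [ (λ j → ⊥-elim (<⇒≢ (∈env-< ρ j) refl)) , (λ j → ⟨⟩-injʳ (to ∈sg j)) ]′ (to ∈∪ i))
    (λ { refl → from ∈∪ (inj₂ (from ∈sg refl)) })
  ∈env {suc n} (x ∷ ρ) (suc i) = mk⇔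
    (λ h → [ to (∈env ρ i) , (λ j → ⊥-elim (<⇒≢ (name-< i) (num-inj (⟨⟩-injˡ (to ∈sg j))))) ]′ (to ∈∪ h))
    (λ e → from ∈∪ (inj₁ (from (∈env ρ i) e)))

  vacuous : ∀ i j {_ : False (i ≟ j)} {B : Set ℓ} → num i ≡ num j → B
  vacuous i j {i≢j} e = ⊥-elim (toWitnessFalse i≢j (num-inj e))

  holds-tower : ∀ k t {i j ρ} →
    Holds (tower (suc k)) (num (suc k)) ⟨ num t , ⟨ i , j ⟩ ⟩ ρ ⇔ Clause (tower k) (num k) (num t) i j ρ
  holds-tower k t {i} {j} {ρ} = ⇔-trans holds-next (mk⇔
    (λ (m , e , t' , i' , j' , e' , h) →
      unpair (S-inj e) (⟨⟩-injˡ e') (⟨⟩-injˡ (⟨⟩-injʳ e')) (⟨⟩-injʳ (⟨⟩-injʳ e')) h)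
    (λ h → num k , refl , num t , i , j , refl , h))
    where
    unpair : ∀ {m t' i' j'} → num k ≡ m → num t ≡ t' → i ≡ i' → j ≡ j' →
             Clause (tower k) m t' i' j' ρ → Clause (tower k) (num k) (num t) i j ρ
    unpair refl refl refl refl h = h

  module _ {T : Class U} {m i j ρ : Carrier} where
    opaque
      unfolding Clause

      clause₀ : Clause T m (num 0) i j ρ ⇔ (∃[ x ] ⟨ i , x ⟩ ∈ ρ × ⟨ j , x ⟩ ∈ ρ)
      clause₀ = mk⇔ (λ (c , _) → c refl) λ h → (λ _ → h)
        , vacuous 0 1 , vacuous 0 2 , vacuous 0 3 , vacuous 0 4 , vacuous 0 5

      clause₁ : Clause T m (num 1) i j ρ ⇔ (∃[ x ] ∃[ y ] ⟨ i , x ⟩ ∈ ρ × ⟨ j , y ⟩ ∈ ρ × x ∈ y)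
      clause₁ = mk⇔ (λ (_ , c , _) → c refl) λ h → vacuous 1 0 , (λ _ → h)
        , vacuous 1 2 , vacuous 1 3 , vacuous 1 4 , vacuous 1 5

      clause₂ : Clause T m (num 2) i j ρ ⇔ (∃[ x ] ⟨ i , x ⟩ ∈ ρ × 𝒜 x)
      clause₂ = mk⇔ (λ (_ , _ , c , _) → c refl) λ h → vacuous 2 0 , vacuous 2 1 , (λ _ → h)
        , vacuous 2 3 , vacuous 2 4 , vacuous 2 5

      clause₃ : Clause T m (num 3) i j ρ ⇔ (¬ Holds T m i ρ)
      clause₃ = mk⇔ (λ (_ , _ , _ , c , _) → c refl) λ h → vacuous 3 0 , vacuous 3 1 , vacuous 3 2
        , (λ _ → h) , vacuous 3 4 , vacuous 3 5

      clause₄ : Clause T m (num 4) i j ρ ⇔ (Holds T m i ρ × Holds T m j ρ)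
      clause₄ = mk⇔ (λ (_ , _ , _ , _ , c , _) → c refl) λ h → vacuous 4 0 , vacuous 4 1 , vacuous 4 2
        , vacuous 4 3 , (λ _ → h) , vacuous 4 5

      clause₅ : Clause T m (num 5) i j ρ ⇔ (∃[ x ] Holds T m j (ρ ∪ sg ⟨ i , x ⟩))
      clause₅ = mk⇔ (λ (_ , _ , _ , _ , _ , c) → c refl) λ h → vacuous 5 0 , vacuous 5 1 , vacuous 5 2
        , vacuous 5 3 , vacuous 5 4 , (λ _ → h)

  -- The level is only bounded below by the depth, because both conjuncts of a conjunction are
  -- evaluated at the same level although their depths may differ.
  truth : ∀ {n} (φ : Formula n) ρ k → depth φ ≤ k → Holds (tower k) (num k) (code φ) (env ρ) ⇔ Sat U φ ρ
  truth (i ≐ j) ρ (suc k) _ = ⇔-trans (holds-tower k 0) (⇔-trans clause₀ (mk⇔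
    (λ (x , a , b) → trans (sym (to (∈env ρ i) a)) (to (∈env ρ j) b))
    (λ e → _ , from (∈env ρ i) refl , from (∈env ρ j) e)))
  truth (i ∈̇ j) ρ (suc k) _ = ⇔-trans (holds-tower k 1) (⇔-trans clause₁ (mk⇔
    (λ (x , y , a , b , x∈y) → subst₂ _∈_ (to (∈env ρ i) a) (to (∈env ρ j) b) x∈y)
    (λ h → _ , _ , from (∈env ρ i) refl , from (∈env ρ j) refl , h)))
  truth (𝒜̇ i) ρ (suc k) _ = ⇔-trans (holds-tower k 2) (⇔-trans clause₂ (mk⇔
    (λ (x , a , ux) → subst 𝒜 (to (∈env ρ i) a) ux)
    (λ h → _ , from (∈env ρ i) refl , h)))
  truth (¬̇ φ) ρ (suc k) (s≤s d) = ⇔-trans (holds-tower k 3) (⇔-trans clause₃ (¬-cong-⇔ (truth φ ρ k d)))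
  truth (φ ∧̇ ψ) ρ (suc k) (s≤s d) = ⇔-trans (holds-tower k 4) (⇔-trans clause₄ (_×-⇔_
    (truth φ ρ k (≤-trans (m≤m⊔n (depth φ) (depth ψ)) d))
    (truth ψ ρ k (≤-trans (m≤n⊔m (depth φ) (depth ψ)) d))))
  truth (∃̇ φ) ρ (suc k) (s≤s d) = ⇔-trans (holds-tower k 5) (⇔-trans clause₅ (⇔-∃ λ x → truth φ (x ∷ ρ) k d))

  -- Classes as slices of a truth level

  opaque
    -- c ranges over all objects and not only over codes of genuine formulas; only the extension of
    -- the slice counts.
    Codes : Class U → Class U → Carrier → Carrier → Set ℓ
    Codes X T n w = ∃[ c ] ∃[ z ] w ≡ ⟨ c , z ⟩ × (∀ x → _∈ᶜ_ U x X ⇔ Holds T n c (env (x ∷ z ∷ [])))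

  Coded : Class U → Class U → Carrier → Set ℓ
  Coded X T n = ∃[ w ] Codes X T n w

  opaque
    unfolding Codes

    Codes′ : ∀ {k n f g} (X T : Fin k) → Tm k n f → Tm k n g →
             Fm k n (λ Γ ρ → Codes (lookup Γ X) (lookup Γ T) (f Γ ρ) (g Γ ρ))
    Codes′ X T n w = ∃′ (∃′ (wk (wk w) ≐′ ⟨ var 1F , var 0F ⟩ᵗ ∧′ ∀′ (var 0F ∈ᶜ′ X ⇔′
      -- The assignment `env (x ∷ z ∷ [])` written out: z has name 0 and x has name 1.
      Holds′ T (wk (wk (wk n))) (var 2F) ((∅ᵗ ∪ᵗ sgᵗ ⟨ ∅ᵗ , var 1F ⟩ᵗ) ∪ᵗ sgᵗ ⟨ numᵗ 1 , var 0F ⟩ᵗ))))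

    Coded′ : ∀ {k n f} (X T : Fin k) → Tm k n f → Fm k n (λ Γ ρ → Coded (lookup Γ X) (lookup Γ T) (f Γ ρ))
    Coded′ X T n = ∃′ (Codes′ X T (wk n) (var 0F))

  opaque
    unfolding Codes

    class-coded : ∀ X → ∃[ k ] Coded X (tower k) (num k)
    class-coded ⟪ ψ , z ⟫ = depth ψ , ⟨ code ψ , z ⟩ , code ψ , z , refl ,
      λ x → ⇔-sym (truth ψ (x ∷ z ∷ []) (depth ψ) ≤-refl)

    codes-transfer : ∀ {X X' T T' n w} → _≈ᶜ_ U X X' → (∀ c ρ → Holds T n c ρ ⇔ Holds T' n c ρ) →
                     Codes X T n w → Codes X' T' n w
    codes-transfer X≈ h (c , z , e , k) = c , z , e , λ x → ⇔-trans (⇔-sym (X≈ x)) (⇔-trans (k x) (h _ _))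

    codes-unique : ∀ {X X' T T' n w} → (∀ c ρ → Holds T n c ρ ⇔ Holds T' n c ρ) →
                   Codes X T n w → Codes X' T' n w → _≈ᶜ_ U X X'
    codes-unique h (c , z , refl , k) (c' , z' , e , k') with ⟨⟩-injˡ e | ⟨⟩-injʳ e
    ... | refl | refl = λ x → ⇔-trans (k x) (⇔-trans (h _ _) (⇔-sym (k' x)))

  -- Ranks over a set of urelements

  module _ (urelementSet : UrelementsFormSet U) where
    𝔸 : Carrier
    𝔸 = proj₁ urelementSet

    ∈𝔸 : ∀ {x} → x ∈ 𝔸 ⇔ 𝒜 x
    ∈𝔸 = proj₂ (proj₂ urelementSet) _

    opaque
      -- Step function for the cumulative hierarchy: i is the set of levels of the elements of x.
      -- The hypothesis on the urelements enters here; it makes each level a set, so that Scott's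
      -- trick applies.
      levelOver : Carrier → Carrier → Carrier → Carrier
      levelOver _ _ i = 𝔸 ∪ 𝒫 (⋃ i)

      levelOverᵗ : ∀ {k n f g h} → Tm k n f → Tm k n g → Tm k n h →
                   Tm k n (λ Γ ρ → levelOver (f Γ ρ) (g Γ ρ) (h Γ ρ))
      levelOverᵗ _ _ t = setT (var 0F ∈′ 𝔸ᵗ ∪ᵗ 𝒫ᵗ (⋃ᵗ (wk (wk t)))) (λ _ _ → ∪-set) λ _ _ _ _ → ⇔-refl
        where
        -- `𝔸` is defined from the predicate `𝒜`, so it does not enter the definition of ε as a
        -- parameter.
        𝔸ᵗ : ∀ {k n} → Tm k n (λ _ _ → 𝔸)
        𝔸ᵗ = setT (𝒜′ (var 0F)) (λ _ _ → proj₁ (proj₂ urelementSet)) λ _ _ _ _ → ∈𝔸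

      ∈levelOver : ∀ {p x i w} → w ∈ levelOver p x i ⇔ (𝒜 w ⊎ (IsSet U w × w ⊆ ⋃ i))
      ∈levelOver = mk⇔ (λ j → [ inj₁ ∘ to ∈𝔸 , inj₂ ∘ to ∈𝒫 ]′ (to ∈∪ j))
        (λ h → from ∈∪ ([ inj₁ ∘ from ∈𝔸 , inj₂ ∘ from ∈𝒫 ]′ h))

    open Recursion levelOver levelOverᵗ using (F; Fᵗ; F″; F″-set; ∈F″; F-eq)

    -- With α the rank of x, level x is V_{α+1} and below x is V_α, over the urelements
    -- (but below x is empty for α = 0).
    level : Carrier → Carrier
    level = F ∅

    opaque
      below : Carrier → Carrier
      below x = ⋃ (F″ ∅ x)

      below-set : ∀ {x} → IsSet U (below x)
      below-set = ⋃-set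

      ∈below : ∀ {x w} → w ∈ below x ⇔ (∃[ u ] u ∈ x × w ∈ level u)
      ∈below {x} {w} = mk⇔
        (λ i → let (v , v∈ , w∈v) = to ∈⋃ i
                   (u , u∈x , e) = to ∈F″ v∈
               in u , u∈x , subst (w ∈_) e w∈v)
        (λ (u , u∈x , i) → from ∈⋃ (level u , from ∈F″ (u , u∈x , refl) , i))

      ∈level : ∀ {x w} → w ∈ level x ⇔ (𝒜 w ⊎ (IsSet U w × w ⊆ below x))
      ∈level {x} {w} = subst (λ l → w ∈ l ⇔ (𝒜 w ⊎ (IsSet U w × w ⊆ below x))) (sym (F-eq ∅ x)) ∈levelOver

      levelᵗ : ∀ {k n f} → Tm k n f → Tm k n (λ Γ ρ → level (f Γ ρ))
      levelᵗ t = Fᵗ ∅ᵗ t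

      belowᵗ : ∀ {k n f} → Tm k n f → Tm k n (λ Γ ρ → below (f Γ ρ))
      belowᵗ t = setT (∃′ (var 0F ∈′ wk (wk (wk t)) ∧′ var 1F ∈′ levelᵗ (var 0F)))
        (λ _ _ → below-set) λ _ _ _ _ → ∈below

    level-mono : ∀ {x y} → below x ⊆ below y → level x ⊆ level y
    level-mono h w i = from ∈level ([ inj₁ , (λ (s , k) → inj₂ (s , λ v j → h v (k v j))) ]′ (to ∈level i))

    level⊆below : ∀ {u x} → u ∈ x → level u ⊆ below x
    level⊆below u∈x w i = from ∈below (_ , u∈x , i)

    below∈level : ∀ x → below x ∈ level x
    below∈level x = from ∈level (inj₂ (below-set , λ _ → id))

    ∈-own-level : ∀ x → x ∈ level x
    ∈-own-level = ∈-ind {k = 0} (var 0F ∈′ levelᵗ (var 0F)) [] [] λ x ih → from ∈level (cases x ih em)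
      where
      cases : ∀ x → (∀ y → y ∈ x → y ∈ level y) → Dec (𝒜 x) → 𝒜 x ⊎ (IsSet U x × x ⊆ below x)
      cases x ih (yes ux) = inj₁ ux
      cases x ih (no nx)  = inj₂ (nx , λ w i → level⊆below i w (ih w i))

    -- Comparability of ranks without ordinals. If some u ∈ x has `level u` not included in
    -- `below y`, the induction hypothesis puts the level of every element of y inside `below u`;
    -- then `level y` is included in `level u`, hence in `below x`.
    below-comparable : ∀ x y → below x ⊆ below y ⊎ level y ⊆ below x
    below-comparable = ∈-ind {k = 0}
      (∀′ ((belowᵗ (var 1F) ⊆′ belowᵗ (var 0F)) ∨′ (levelᵗ (var 0F) ⊆′ belowᵗ (var 1F)))) [] [] step
      where
      step : ∀ x → (∀ u → u ∈ x → ∀ y → below u ⊆ below y ⊎ level y ⊆ below u) →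
             ∀ y → below x ⊆ below y ⊎ level y ⊆ below x
      step x ih y with em {∃[ u ] u ∈ x × ¬ level u ⊆ below y}
      ... | no h = inj₁ λ w i → let (u , u∈x , w∈) = to ∈below i in stable λ w∉ → h (u , u∈x , λ k → w∉ (k w w∈))
      ... | yes (u , u∈x , h) = inj₂ λ w i → level⊆below u∈x w (level-mono
        (λ v j → let (t , t∈y , v∈) = to ∈below j in
          [ (λ k → ⊥-elim (h λ r r∈ → level⊆below t∈y r (level-mono k r r∈))) , (λ k → k v v∈) ]′ (ih u u∈x t)) w i)

    -- The sets `below x` themselves serve as ranks: as `below w` belongs to `level w`, a smaller
    -- rank is an element of a larger one, and ∈-minimality yields a least rank.
    minimal-rank : ∀ {k n P} (φ : Fm k (suc n) P) Γ ρ → ∃[ x ] P Γ (x ∷ ρ) →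
                   ∃[ x ] P Γ (x ∷ ρ) × (∀ y → P Γ (y ∷ ρ) → below x ⊆ below y)
    minimal-rank φ Γ ρ (x , p) with ∈-minimal (∃′ (skip φ ∧′ var 1F ≐′ belowᵗ (var 0F))) Γ ρ (below x , x , p , refl)
    ... | _ , (y , q , refl) , m = y , q , λ w r →
      [ id , (λ k → ⊥-elim (m (below w) (k _ (below∈level w)) (w , r , refl))) ]′ (below-comparable y w)

    -- The abstraction map

    LeastCode : Class U → Class U → Carrier → Carrier → Set ℓ
    LeastCode X T n w = Codes X T n w × (∀ w' → Codes X T n w' → below w ⊆ below w')

    -- T may be any hierarchy that reaches level n. The level is recorded in y because the same code
    -- may give different classes at different levels.
    Abstract : Class U → Class U → Carrier → Set ℓ
    Abstract X T y = ∃[ n ] n ∈ ω × Hierarchy T n × Coded X T n × (∀ m → m ∈ n → ¬ Coded X T m) ×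
      (∃[ s ] y ≡ ⟨ n , s ⟩ × IsSet U s × (∀ w → w ∈ s ⇔ LeastCode X T n w))

    opaque
      LeastCode′ : ∀ {k n f g} (X T : Fin k) → Tm k n f → Tm k n g →
                   Fm k n (λ Γ ρ → LeastCode (lookup Γ X) (lookup Γ T) (f Γ ρ) (g Γ ρ))
      LeastCode′ X T n w = Codes′ X T n w ∧′ ∀′ (Codes′ X T (wk n) (var 0F) ⇒′ (belowᵗ (wk w) ⊆′ belowᵗ (var 0F)))

      Abstract′ : Fm 2 1 (λ Γ ρ → Abstract (lookup Γ 1F) (lookup Γ 0F) (lookup ρ 0F))
      Abstract′ = ∃′ (var 0F ∈′ ωᵗ ∧′ Hierarchy′ 0F (var 0F) ∧′ Coded′ 1F 0F (var 0F) ∧′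
        ∀′ (var 0F ∈′ var 1F ⇒′ ¬′ Coded′ 1F 0F (var 0F)) ∧′
        ∃′ (var 2F ≐′ ⟨ var 1F , var 0F ⟩ᵗ ∧′ (¬′ 𝒜′ (var 0F)) ∧′
          ∀′ (var 0F ∈′ var 1F ⇔′ LeastCode′ 1F 0F (var 2F) (var 0F))))

    least-code : ∀ {X T n} → Coded X T n → ∃[ w ] LeastCode X T n w
    least-code {X} {T} {n} c = minimal-rank (Codes′ 0F 1F (var 1F) (var 0F)) (X ∷ T ∷ []) (n ∷ []) c

    opaque
      abstraction : ∀ X → ∃[ y ] ∃[ T ] Abstract X T y
      abstraction X with class-coded X
      -- The search is confined to `S (num k)`, since the tower is known to be a hierarchy only up
      -- to `num k`.
      ... | k , coded with ∈-minimal (var 0F ∈′ Sᵗ (var 1F) ∧′ Coded′ 0F 1F (var 0F)) (X ∷ tower k ∷ []) (num k ∷ [])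
                            (num k , from ∈S (inj₂ refl) , coded)
      ...   | n , (n∈ , coded-n) , least with least-code coded-n
      ...     | w₀ , l₀ = ⟨ n , s ⟩ , T , n , ⊆ω (S∈ω (num∈ω k)) n n∈
        , hierarchy-restrict (num∈ω k) n∈ (tower-hierarchy k) , coded-n
        , (λ m m∈n c → least m m∈n (S-transitive (num∈ω k) n n∈ m m∈n , c))
        , s , refl , sep-set , λ w → mk⇔
            (λ i → proj₂ (to (∈sep {φ = φ}) i))
            -- A least code has rank at most that of w₀, so it lies in `level w₀`; separating from
            -- that level loses none.
            (λ l → from (∈sep {φ = φ}) (level-mono (proj₂ l w₀ (proj₁ l₀)) w (∈-own-level w) , l))
        where
        T : Class U
        T = tower k
        φ : Fm 2 2 (λ Γ ρ → LeastCode (lookup Γ 0F) (lookup Γ 1F) (lookup ρ 1F) (lookup ρ 0F))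
        φ = LeastCode′ 0F 1F (var 1F) (var 0F)
        s : Carrier
        s = sep φ (X ∷ T ∷ []) (n ∷ []) (level w₀)

    leastCode-transfer : ∀ {X X' T T' n w} → _≈ᶜ_ U X X' → (∀ c ρ → Holds T n c ρ ⇔ Holds T' n c ρ) →
                         LeastCode X T n w → LeastCode X' T' n w
    leastCode-transfer X≈ h (c , l) = codes-transfer X≈ h c , λ w' c' →
      l w' (codes-transfer (λ x → ⇔-sym (X≈ x)) (λ c ρ → ⇔-sym (h c ρ)) c')

    abstract-unique : ∀ {X X' T T' y y'} → _≈ᶜ_ U X X' → Abstract X T y → Abstract X' T' y' → y ≡ y'
    abstract-unique {X} {X'} {T} {T'} X≈
      (n , n∈ω , H , c , least , s , refl , ss , hs) (n' , n'∈ω , H' , c' , least' , s' , refl , ss' , hs')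
      with ∈-trichotomy n∈ω n'∈ω
    ... | inj₁ i = ⊥-elim (least' n i (proj₁ c , codes-transfer X≈
            (hierarchy-unique n∈ω n'∈ω H H' n (from ∈S (inj₂ refl)) (from ∈S (inj₁ i))) (proj₂ c)))
    ... | inj₂ (inj₂ i) = ⊥-elim (least n' i (proj₁ c' , codes-transfer (λ x → ⇔-sym (X≈ x))
            (hierarchy-unique n'∈ω n∈ω H' H n' (from ∈S (inj₂ refl)) (from ∈S (inj₁ i))) (proj₂ c')))
    ... | inj₂ (inj₁ refl) = cong ⟨ n ,_⟩ (⊆-antisym ss ss'
            (λ w i → from (hs' w) (leastCode-transfer X≈ agree (to (hs w) i)))
            (λ w i → from (hs w) (leastCode-transfer (λ x → ⇔-sym (X≈ x)) (λ c ρ → ⇔-sym (agree c ρ)) (to (hs' w) i))))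
      where
      agree : ∀ c ρ → Holds T n c ρ ⇔ Holds T' n c ρ
      agree = hierarchy-unique n∈ω n'∈ω H H' n (from ∈S (inj₂ refl)) (from ∈S (inj₂ refl))

    -- Equal values share a nonempty set of least codes at the same level, and one common code
    -- determines the class.
    abstract-injective : ∀ {X X' T T' y} → Abstract X T y → Abstract X' T' y → _≈ᶜ_ U X X'
    abstract-injective {X} {X'} {T} {T'}
      (n , n∈ω , H , c , _ , s , refl , _ , hs) (n' , n'∈ω , H' , _ , _ , s' , e , _ , hs')
      with ⟨⟩-injˡ e | ⟨⟩-injʳ e | least-code c
    ... | refl | refl | w , l = codes-unique
      (hierarchy-unique n∈ω n'∈ω H H' n (from ∈S (inj₂ refl)) (from ∈S (inj₂ refl)))
      (proj₁ l) (proj₁ (to (hs' w) (from (hs w) l)))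

    set⇒definable : ∃[ ε ] Definable U ε × BasicLawV U ε
    -- The class quantifier binds T; `abstract-unique` guarantees that every witness T yields the
    -- value computed from the tower.
    set⇒definable = ε , (∃̂ compile Abstract′ id , λ X y → ⇔-trans (mk⇔
        (λ { refl → proj₂ (abstraction X) })
        (λ (T , h) → abstract-unique (λ _ → ⇔-refl) (proj₂ (proj₂ (abstraction X))) h))
      (⇔-∃ λ T → ⇔-sym (compile-sat Abstract′ id (T ∷ X ∷ []) {y ∷ []} {y ∷ []} λ _ → refl)))
      , λ X Y → mk⇔
        (λ e → abstract-injective (proj₂ (proj₂ (abstraction X)))
          (subst (Abstract Y _) (sym e) (proj₂ (proj₂ (abstraction Y)))))
        (λ X≈Y → abstract-unique X≈Y (proj₂ (proj₂ (abstraction X))) (proj₂ (proj₂ (abstraction Y))))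
      where
      ε : Class U → Carrier
      ε X = proj₁ (abstraction X)

  -- From definable to parametrically definable

  renameClasses : ∀ {k l n} → (Fin k → Fin l) → Formula₂ k n → Formula₂ l n
  renameClasses r (i ≐ j) = i ≐ j
  renameClasses r (i ∈̇ j) = i ∈̇ j
  renameClasses r (𝒜̇ i)   = 𝒜̇ i
  renameClasses r (i ∈̂ j) = i ∈̂ r j
  renameClasses r (¬̇ φ)   = ¬̇ renameClasses r φ
  renameClasses r (φ ∧̇ ψ) = renameClasses r φ ∧̇ renameClasses r ψ
  renameClasses r (∃̇ φ)   = ∃̇ renameClasses r φ
  renameClasses r (∃̂ φ)   = ∃̂ renameClasses (lift r) φ

  renameClasses-sat : ∀ {k l n} (r : Fin k → Fin l) (φ : Formula₂ k n) {Γ Γ' ρ} →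
    (∀ j → lookup Γ' (r j) ≡ lookup Γ j) → Sat₂ U (renameClasses r φ) Γ' ρ ⇔ Sat₂ U φ Γ ρ
  renameClasses-sat r (i ≐ j) R = ⇔-refl
  renameClasses-sat r (i ∈̇ j) R = ⇔-refl
  renameClasses-sat r (𝒜̇ i)   R = ⇔-refl
  renameClasses-sat r (i ∈̂ j) R rewrite R j = ⇔-refl
  renameClasses-sat r (¬̇ φ)   R = ¬-cong-⇔ (renameClasses-sat r φ R)
  renameClasses-sat r (φ ∧̇ ψ) R = _×-⇔_ (renameClasses-sat r φ R) (renameClasses-sat r ψ R)
  renameClasses-sat r (∃̇ φ)   R = ⇔-∃ λ x → renameClasses-sat r φ R
  renameClasses-sat r (∃̂ φ)   R = ⇔-∃ λ X → renameClasses-sat (lift r) φ λ { zero → refl ; (suc j) → R j }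

  definable⇒parametric : (∃[ ε ] Definable U ε × BasicLawV U ε) → ∃[ ε ] ParametricallyDefinable U ε × BasicLawV U ε
  definable⇒parametric (ε , (φ , def) , blv) = ε , (renameClasses inject₁ φ , ⟪ 0F ≐ 0F , ∅ ⟫ ,
    λ X y → ⇔-trans (def X y) (⇔-sym (renameClasses-sat inject₁ φ λ { zero → refl }))) , blv

theorem4 : ∀ {ℓ : Level} → ExcludedMiddle ℓ →
    (U : Structure ℓ) → ZFUR U → DCScheme U →
    (UrelementsFormSet U ⇔ (∃[ ε ] Definable U ε × BasicLawV U ε))
    × ((∃[ ε ] Definable U ε × BasicLawV U ε) ⇔ (∃[ ε ] ParametricallyDefinable U ε × BasicLawV U ε))
theorem4 em U zf dc =
  mk⇔ set⇒definable (parametric⇒set ∘ definable⇒parametric) ,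
  mk⇔ definable⇒parametric (set⇒definable ∘ parametric⇒set)
  where open Proof em U zf dc
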